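{- For every integer $r\ge 2$ there exist a constant $c_r>0$ and $n_0$ such that for all $n\ge n_0$, $$t^{(r)}(n)\ge c_r\, n^{\frac{3}{5}\cdot\frac{1}{2^{r-1}-1}},$$ i.e. $t^{(r)}(n)=\Omega\left(n^{\frac{3}{5}\cdot\frac{1}{2^{r-1}-1}}\right)$.
   Context: An ordered $r$-matching of size $n$ is an $r$-uniform hypergraph on a linearly ordered vertex set $V$ with $|V|=rn$, consisting of $n$ pairwise disjoint edges. Two ordered matchings are isomorphic if there is an order-preserving bijection between their vertex sets inducing a bijection between their edge sets. A pair of twins in an ordered matching $M$ is a pair of vertex-disjoint sub-matchings of $M$ that are isomorphic as ordered matchings; its size is the number of edges of one of them. $t(M)$ is the maximum size of twins in $M$, and $t^{(r)}(n)=\min\{t(M): M \text{ an ordered } r\text{ -matching of size } n\}$. -}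

module Defs where

open import Data.Nat using (ℕ; _*_; _^_; _∸_; _≤_; _<_)
open import Data.Fin using (Fin) renaming (_<_ to _<ᶠ_)
open import Data.Fin.Subset using (Subset; _∈_; ∣_∣)
open import Data.List using (length; filter; allFin)
open import Data.Product using (_×_; Σ)
open import Relation.Binary.PropositionalEquality using (_≡_)
open import Relation.Nullary using (¬_)
open import Function.Bundles using (_⇔_)
open import Data.Fin using (_≟_)

-- An ordered r-matching of size n, up to isomorphism, on the vertex set
-- Fin (r * n) with its natural linear order.  The matching is given by
-- assigning to each vertex the edge (an element of Fin n) containing it;
-- every edge contains exactly r vertices.
record OrderedMatching (r n : ℕ) : Set where
  field
    edgeOf    : Fin (r * n) → Fin n
    edgeSize  : ∀ (e : Fin n) →
                length (filter (λ v → edgeOf v ≟ e) (allFin (r * n))) ≡ r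

open OrderedMatching public

-- A pair of twins in M: two vertex-disjoint sub-matchings (given by their
-- edge sets S and T) together with an order-preserving bijection φ from the
-- vertices of S onto the vertices of T which induces a bijection between
-- the edges (vertices lie in a common edge iff their images do).
record Twins {r n : ℕ} (M : OrderedMatching r n) : Set where
  field
    S T        : Subset n
    disjoint   : ∀ (e : Fin n) → ¬ (e ∈ S × e ∈ T)
    φ          : Fin (r * n) → Fin (r * n)
    maps-into  : ∀ v → edgeOf M v ∈ S → edgeOf M (φ v) ∈ T
    onto       : ∀ w → edgeOf M w ∈ T → Σ (Fin (r * n)) (λ v → edgeOf M v ∈ S × φ v ≡ w)
    monotone   : ∀ u v → edgeOf M u ∈ S → edgeOf M v ∈ S → u <ᶠ v → φ u <ᶠ φ v
    edges      : ∀ u v → edgeOf M u ∈ S → edgeOf M v ∈ S →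
                 (edgeOf M u ≡ edgeOf M v) ⇔ (edgeOf M (φ u) ≡ edgeOf M (φ v))

twinSize : ∀ {r n} {M : OrderedMatching r n} → Twins M → ℕ
twinSize tw = ∣ Twins.S tw ∣

expDen : ℕ → ℕ
expDen r = 5 * (2 ^ (r ∸ 1) ∸ 1)

{-# OPTIONS --safe #-}
module Submission where

-- Two stages.  First, an Erdős–Szekeres argument applied to all vertices of the edges but the last:
-- as long as the edges are cut into b separated runs, either there is a chain of length L for one of
-- the 2^(b-1) relative orientations of the runs, or many edges pairwise overlap in some run; then a
-- vertex of one edge lies in the same gap of a constant fraction of the others, and cutting there
-- gives b + 1 runs.  The losses multiply to L^(1 + 2 + … + 2^(r-2)) = L^(2^(r-1) - 1).
--
-- Second, in such a chain of m edges only the last vertices are unconstrained, and it has twins of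
-- size of order m^(3/5).  If many last vertices of the first half lie beyond the middle of the chain,
-- they form a permutation, and the argument of Bukh and Rudenko applies: put the last vertices into
-- about u³ buckets (m ~ u⁵), and in each of u² successive groups of about u³ edges find about u³
-- triples with last vertices in a common bucket; any two triples are ordered alike in two of their
-- three coordinates, so two coordinates share a chain of length u, after which the edges in the
-- buckets of this chain are discarded.  Otherwise the two halves essentially do not interact, and
-- twins in each are put together by induction.

open import Defs
open import Data.Nat using (ℕ; _*_; _^_; _≤_)
open import Data.Product using (Σ; _×_)

open import Level using (0ℓ)
open import Data.Bool using (Bool; true; false)
open import Data.Fin using (Fin; zero; suc; toℕ; cast) renaming (_<_ to _<ᶠ_; _≟_ to _≟ᶠ_)
open import Data.Fin.Properties using (toℕ-injective; toℕ<n; toℕ-cast; cast-involutive)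
open import Data.Fin.Subset using (Subset; ∣_∣; ⁅_⁆; _∪_; ⊥) renaming (_∈_ to _∈ˢ_)
open import Data.Fin.Subset.Properties using (x∈⁅x⁆; x∈⁅y⁆⇒x≡y; x∈p∪q⁺; x∈p∪q⁻; ∉⊥; p⊂q⇒∣p∣<∣q∣)
open import Data.List using (List; []; _∷_; length; filter; map; _++_; allFin; take; drop; upTo)
import Data.List as List
open import Data.List.Membership.Propositional using (_∈_; lose; find)
open import Data.List.Membership.Propositional.Properties
  using (∈-filter⁻; ∈-filter⁺; ∈-map⁺; ∈-map⁻; ∈-++⁺ˡ; ∈-++⁺ʳ; ∈-++⁻; ∈-allFin; ∈-lookup; ∈-upTo⁺)
open import Data.List.Properties
  using (length-++; length-map; length-tabulate; length-take; length-upTo; length-filter; take++drop≡id)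
open import Data.List.Relation.Binary.Permutation.Propositional using (_↭_; ↭-sym; ↭⇒↭ₛ)
open import Data.List.Relation.Binary.Permutation.Propositional.Properties using (∈-resp-↭; ↭-length)
open import Data.List.Relation.Binary.Permutation.Setoid.Properties using (Unique-resp-↭)
open import Data.List.Relation.Binary.Sublist.Propositional using (_⊆_; []; _∷_; _∷ʳ_; ⊆-trans; ⊆-refl; lookup)
open import Data.List.Relation.Binary.Sublist.Propositional.Properties
  using (filter-⊆; take-⊆; drop-⊆; All-resp-⊆; length-mono-≤)
import Data.List.Relation.Binary.Sublist.Propositional.Properties as Sublist
open import Data.List.Relation.Unary.All as All using (All; []; _∷_)
import Data.List.Relation.Unary.All.Properties as All
open import Data.List.Relation.Unary.AllPairs as AllPairs using (AllPairs; []; _∷_)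
import Data.List.Relation.Unary.AllPairs.Properties as AllPairs
open import Data.List.Relation.Unary.Any as Any using (Any; here; there)
open import Data.List.Relation.Unary.Any.Properties using (lookup-index)
open import Data.List.Relation.Unary.Linked.Properties using (Linked⇒AllPairs)
open import Data.List.Relation.Unary.Unique.Propositional using (Unique)
open import Data.List.Relation.Unary.Unique.Propositional.Properties using (allFin⁺)
import Data.List.Sort as Sort
open import Data.Nat hiding (_*_; _^_; _≤_; ℕ)
open import Data.Nat.DivMod using (_/_; _%_; m≡m%n+[m/n]*n; m%n<n; /-monoˡ-≤; m*n/n≡m)
open import Data.Nat.ListAction using (sum)
open import Data.Nat.Properties
open import Data.Nat.Solver using (module +-*-Solver)
open import Data.Nat.Tactic.RingSolver using (solve-∀)
open import Data.Product as Product using (∃; _,_; proj₁; proj₂)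
open import Data.Sum using (_⊎_; inj₁; inj₂)
open import Data.Unit using (tt)
open import Function using (_∘_; id)
open import Function.Bundles using (mk⇔)
open import Relation.Binary using (Rel; Transitive; tri<; tri≈; tri>) renaming (Decidable to Decidable₂)
import Relation.Binary.Construct.On as On
open import Relation.Binary.PropositionalEquality
open import Relation.Nullary using (¬_; yes; no; contradiction; Dec; _×-dec_)
open import Relation.Unary using (Pred; Decidable)
open import Relation.Unary.Properties using (∁?)

open +-*-Solver using (solve; _:*_; _:+_; _:^_; _:=_; con)

-- Counting and pairwise relations in lists

private variable A I : Set

module _ {P : Pred A 0ℓ} (P? : Decidable P) where

  length-filter-∁ : ∀ xs → length (filter P? xs) + length (filter (∁? P?) xs) ≡ length xs
  length-filter-∁ []       = refl
  length-filter-∁ (x ∷ xs) with P? x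
  ... | yes _ = cong suc (length-filter-∁ xs)
  ... | no  _ = trans (+-suc _ _) (cong suc (length-filter-∁ xs))

AllPairs-resp-⊆ : {R : Rel A 0ℓ} {xs ys : List A} → ys ⊆ xs → AllPairs R xs → AllPairs R ys
AllPairs-resp-⊆ []         []       = []
AllPairs-resp-⊆ (_ ∷ʳ τ)   (_ ∷ ps) = AllPairs-resp-⊆ τ ps
AllPairs-resp-⊆ (refl ∷ τ) (p ∷ ps) = All-resp-⊆ τ p ∷ AllPairs-resp-⊆ τ ps

AllPairs-lookup : {R : Rel A 0ℓ} {xs : List A} {x y : A} → AllPairs R xs → x ∈ xs → y ∈ xs →
                  x ≡ y ⊎ R x y ⊎ R y x
AllPairs-lookup (p ∷ ps) (here refl) (here refl) = inj₁ refl
AllPairs-lookup (p ∷ ps) (here refl) (there y∈)  = inj₂ (inj₁ (All.lookup p y∈))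
AllPairs-lookup (p ∷ ps) (there x∈)  (here refl) = inj₂ (inj₂ (All.lookup p x∈))
AllPairs-lookup (p ∷ ps) (there x∈)  (there y∈)  = AllPairs-lookup ps x∈ y∈

-- A chain follows the relation `R`, not the order of `xs`, so its elements are required to be
-- members of `xs` and not to form a sublist.
record Chain (R : Rel A 0ℓ) (xs : List A) (k : ℕ) : Set where
  constructor mkChain
  field
    elems   : List A
    size    : length elems ≡ k
    members : All (_∈ xs) elems
    ordered : AllPairs R elems

Avoids : Rel A 0ℓ → List A → Set
Avoids R ys = ∀ {x y} → x ∈ ys → y ∈ ys → ¬ R x y

Chain-resp-⊆ : {R : Rel A 0ℓ} {xs ys : List A} {k : ℕ} → ys ⊆ xs → Chain R ys k → Chain R xs k
Chain-resp-⊆ τ (mkChain c eq mem ord) = mkChain c eq (All.map (lookup τ) mem) ord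

-- Mirsky's theorem for one and for several relations

module _ {R : Rel A 0ℓ} (R? : Decidable₂ R) (R-trans : Transitive R) where

  -- The elements without a predecessor form an antichain; a chain among the others can be
  -- prolonged downwards.
  mirsky : ∀ L m xs → L * m < length xs →
           Chain R xs (suc L) ⊎ ∃ λ ys → ys ⊆ xs × m < length ys × Avoids R ys
  mirsky zero    m (x ∷ xs) _ = inj₁ (mkChain (x ∷ []) refl (here refl ∷ []) ([] ∷ []))
  mirsky (suc L) m xs       Lm<xs
    with m <? length (filter (∁? (λ x → Any.any? (λ y → R? y x) xs)) xs)
  ... | yes m<M = inj₂ (_ , filter-⊆ _ xs , m<M , λ x∈ y∈ Rxy →
          proj₂ (∈-filter⁻ (∁? (λ x → Any.any? (λ y → R? y x) xs)) {xs = xs} y∈)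
            (lose (proj₁ (∈-filter⁻ (∁? (λ x → Any.any? (λ y → R? y x) xs)) {xs = xs} x∈)) Rxy))
  ... | no  m≮M with mirsky L m (filter (λ x → Any.any? (λ y → R? y x) xs) xs) Lm<N
    where
    N = length (filter (λ x → Any.any? (λ y → R? y x) xs) xs)
    Lm<N : L * m < N
    Lm<N = +-cancelˡ-< m _ _ (begin-strict
      m + L * m  <⟨ Lm<xs ⟩
      length xs  ≡⟨ length-filter-∁ (λ x → Any.any? (λ y → R? y x) xs) xs ⟨
      N + _      ≤⟨ +-monoʳ-≤ N (≮⇒≥ m≮M) ⟩
      N + m      ≡⟨ +-comm N m ⟩
      m + N      ∎) where open ≤-Reasoning
  ... | inj₂ (ys , ys⊆ , m<ys , av) = inj₂ (ys , ⊆-trans ys⊆ (filter-⊆ _ xs) , m<ys , av)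
  ... | inj₁ (mkChain (x ∷ c) eq (x∈ ∷ mem) (Rx ∷ ord))
    with find (proj₂ (∈-filter⁻ (λ x → Any.any? (λ y → R? y x) xs) {xs = xs} x∈))
  ... | y , y∈ , Ryx = inj₁ (mkChain (y ∷ x ∷ c) (cong suc eq)
          (y∈ ∷ All.map (lookup (filter-⊆ _ xs)) (x∈ ∷ mem))
          ((Ryx ∷ All.map (R-trans Ryx) Rx) ∷ Rx ∷ ord))

module _ {R : I → Rel A 0ℓ} (R? : ∀ i → Decidable₂ (R i)) where

  -- `mirsky` is applied to the relations in turn. A relation without a long chain costs a factor
  -- `L`, and avoidance passes to sublists, so what is left in the end avoids them all.
  mirskys : ∀ is → All (λ i → Transitive (R i)) is → ∀ L m xs → L ^ length is * m < length xs →
            (∃ λ i → i ∈ is × Chain (R i) xs (suc L)) ⊎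
            (∃ λ ys → ys ⊆ xs × m < length ys × All (λ i → Avoids (R i) ys) is)
  mirskys []       []       L m xs m<xs = inj₂ (xs , ⊆-refl , subst (_< length xs) (+-identityʳ m) m<xs , [])
  mirskys (i ∷ is) (t ∷ ts) L m xs <xs
    with mirsky (R? i) t L (L ^ length is * m) xs (subst (_< length xs) (*-assoc L (L ^ length is) m) <xs)
  ... | inj₁ c = inj₁ (i , here refl , c)
  ... | inj₂ (ys , ys⊆ , <ys , av) with mirskys is ts L m ys <ys
  ...   | inj₁ (j , j∈ , c) = inj₁ (j , there j∈ , Chain-resp-⊆ ys⊆ c)
  ...   | inj₂ (zs , zs⊆ , <zs , avs) =
            inj₂ (zs , ⊆-trans zs⊆ ys⊆ , <zs , (λ x∈ y∈ → av (lookup zs⊆ x∈) (lookup zs⊆ y∈)) ∷ avs)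

-- Pigeonhole principles

sum-pigeonhole : ∀ (f : A → ℕ) k xs → length xs * k < sum (map f xs) → ∃ λ x → x ∈ xs × k < f x
sum-pigeonhole f k (x ∷ xs) lt with k <? f x
... | yes k<fx = x , here refl , k<fx
... | no  k≮fx with sum-pigeonhole f k xs (+-cancelˡ-< k _ _ (<-≤-trans lt (+-monoˡ-≤ _ (≮⇒≥ k≮fx))))
...   | y , y∈ , k<fy = y , there y∈ , k<fy

module _ {H : I → Pred A 0ℓ} (H? : ∀ c → Decidable (H c)) where

  -- The classes may overlap. A class with at most `k` elements is removed together with its colour,
  -- and the rest still has more than `k` elements per colour.
  colour-pigeonhole : ∀ cs k xs → All (λ x → Any (λ c → H c x) cs) xs → length cs * k < length xs →
                      ∃ λ c → c ∈ cs × k < length (filter (H? c) xs)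
  colour-pigeonhole []       k (x ∷ xs) (() ∷ _) _
  colour-pigeonhole (c ∷ cs) k xs all lt with k <? length (filter (H? c) xs)
  ... | yes k<c = c , here refl , k<c
  ... | no  k≮c with colour-pigeonhole cs k (filter (∁? (H? c)) xs) all′ lt′
    where
    all′ : All (λ x → Any (λ c → H c x) cs) (filter (∁? (H? c)) xs)
    all′ = All.tabulate λ x∈ → let x∈xs , ¬Hcx = ∈-filter⁻ (∁? (H? c)) {xs = xs} x∈ in
                               Any.tail ¬Hcx (All.lookup all x∈xs)
    lt′ : length cs * k < length (filter (∁? (H? c)) xs)
    lt′ = +-cancelˡ-< k _ _ (<-≤-trans lt (≤-trans (≤-reflexive (sym (length-filter-∁ (H? c) xs)))
                                                   (+-monoˡ-≤ _ (≮⇒≥ k≮c))))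
  ...   | d , d∈ , k<d = d , there d∈ , <-≤-trans k<d (length-mono-≤
            (Sublist.filter⁺ (H? d) (H? d) (λ { refl h → h }) (filter-⊆ (∁? (H? c)) xs)))

-- Tournaments

module _ {D : Rel A 0ℓ} (D? : Decidable₂ D) where

  private
    outdeg indeg : List A → A → ℕ
    outdeg ys x = length (filter (D? x) ys)
    indeg  xs y = length (filter (λ x → D? x y) xs)

    arcs : List A → List A → ℕ
    arcs xs ys = sum (map (outdeg ys) xs)

    outdeg-∷ : ∀ x y ys → outdeg ys x ≤ outdeg (y ∷ ys) x
    outdeg-∷ x y ys = length-mono-≤ (Sublist.filter⁺ (D? x) (D? x) (λ { refl h → h }) (y ∷ʳ ⊆-refl))

    arcs-∷ : ∀ y ys xs → indeg xs y + arcs xs ys ≤ arcs xs (y ∷ ys)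
    arcs-∷ y ys []       = z≤n
    arcs-∷ y ys (x ∷ xs) with D? x y
    ... | yes Dxy = begin
      suc (indeg xs y + (outdeg ys x + arcs xs ys))  ≡⟨ cong suc (rearrange (indeg xs y) (outdeg ys x) _) ⟩
      suc (outdeg ys x + (indeg xs y + arcs xs ys))  ≤⟨ s≤s (+-monoʳ-≤ (outdeg ys x) (arcs-∷ y ys xs)) ⟩
      suc (outdeg ys x + arcs xs (y ∷ ys))           ∎
      where open ≤-Reasoning
            rearrange : ∀ a b c → a + (b + c) ≡ b + (a + c)
            rearrange = solve-∀
    ... | no ¬Dxy = begin
      indeg xs y + (outdeg ys x + arcs xs ys)        ≡⟨ rearrange (indeg xs y) (outdeg ys x) _ ⟩
      outdeg ys x + (indeg xs y + arcs xs ys)        ≤⟨ +-monoʳ-≤ (outdeg ys x) (arcs-∷ y ys xs) ⟩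
      outdeg ys x + arcs xs (y ∷ ys)                 ∎
      where open ≤-Reasoning
            rearrange : ∀ a b c → a + (b + c) ≡ b + (a + c)
            rearrange = solve-∀

    degree-sum : ∀ {x ys} → All (λ y → D x y ⊎ D y x) ys → length ys ≤ outdeg ys x + indeg ys x
    degree-sum []                       = z≤n
    degree-sum {x} {y ∷ ys} (d ∷ ds) with D? x y | D? y x
    ... | yes _   | yes _   = s≤s (≤-trans (degree-sum ds) (+-monoʳ-≤ (outdeg ys x) (n≤1+n _)))
    ... | yes _   | no _    = s≤s (degree-sum ds)
    ... | no _    | yes _   = ≤-trans (s≤s (degree-sum ds)) (≤-reflexive (sym (+-suc _ _)))
    ... | no ¬Dxy | no ¬Dyx with d
    ...   | inj₁ Dxy = contradiction Dxy ¬Dxy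
    ...   | inj₂ Dyx = contradiction Dyx ¬Dyx

    -- Each of the n(n - 1)/2 pairs carries at least one arc; the bound is written without
    -- subtraction and division. Adding `y` adds the arcs from and to `y`, at least one for each
    -- element of `ys`.
    handshake : ∀ ys → AllPairs (λ x y → D x y ⊎ D y x) ys →
                length ys * length ys ≤ 2 * arcs ys ys + length ys
    handshake []       []       = z≤n
    handshake (y ∷ ys) (d ∷ ds) = begin
      suc n * suc n                                           ≡⟨ square n ⟩
      n * n + (n + n + 1)                                     ≤⟨ +-monoˡ-≤ _ (handshake ys ds) ⟩
      2 * arcs ys ys + n + (n + n + 1)                        ≡⟨ regroup (arcs ys ys) n ⟩
      2 * (n + arcs ys ys) + suc n                            ≤⟨ +-monoˡ-≤ (suc n) (*-monoʳ-≤ 2 step) ⟩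
      2 * arcs (y ∷ ys) (y ∷ ys) + suc n                      ∎
      where
      open ≤-Reasoning
      n = length ys
      square : ∀ n → suc n * suc n ≡ n * n + (n + n + 1)
      square = solve-∀
      regroup : ∀ a n → 2 * a + n + (n + n + 1) ≡ 2 * (n + a) + suc n
      regroup = solve-∀
      step : n + arcs ys ys ≤ arcs (y ∷ ys) (y ∷ ys)
      step = begin
        n + arcs ys ys                                ≤⟨ +-monoˡ-≤ _ (degree-sum d) ⟩
        outdeg ys y + indeg ys y + arcs ys ys         ≡⟨ +-assoc (outdeg ys y) _ _ ⟩
        outdeg ys y + (indeg ys y + arcs ys ys)       ≤⟨ +-mono-≤ (outdeg-∷ y y ys) (arcs-∷ y ys ys) ⟩
        outdeg (y ∷ ys) y + arcs ys (y ∷ ys)          ∎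

  -- Some out-degree is at least the average, which is at least (n - 1)/2 and so exceeds `k`.
  tournament : ∀ k ys → AllPairs (λ x y → D x y ⊎ D y x) ys → suc (2 * k) < length ys →
               ∃ λ x → x ∈ ys × k < length (filter (D? x) ys)
  tournament k ys ds lt = sum-pigeonhole (outdeg ys) k ys (*-cancelˡ-< 2 _ _ (+-cancelʳ-< n _ _ (begin-strict
      2 * (n * k) + n      ≡⟨ factor n k ⟩
      n * suc (2 * k)      <⟨ *-monoʳ-< n {{>-nonZero (≤-<-trans z≤n lt)}} lt ⟩
      n * n                ≤⟨ handshake ys ds ⟩
      2 * arcs ys ys + n   ∎)))
    where
    open ≤-Reasoning
    n = length ys
    factor : ∀ n k → 2 * (n * k) + n ≡ n * suc (2 * k)
    factor = solve-∀

-- Runs of vertices and the relative orders of edges in them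

-- The scan stops at the first value above `x`; the value before it is below `x`, as `x` is none of
-- the values.
find-gap : ∀ (h : ℕ → ℕ) s n x → h s < x → x < h (s + n) → (∀ {j} → s ≤ j → j ≤ s + n → x ≢ h j) →
           ∃ λ (i : Fin n) → h (s + toℕ i) < x × x < h (suc (s + toℕ i))
find-gap h s zero    x hs<x x<h _ = contradiction hs<x (<⇒≯ (subst (λ k → x < h k) (+-identityʳ s) x<h))
find-gap h s (suc n) x hs<x x<h x≢h with <-cmp x (h (suc s))
... | tri< x<hs′ _ _ = zero , subst (λ k → h k < x × x < h (suc k)) (sym (+-identityʳ s)) (hs<x , x<hs′)
... | tri≈ _ x≡hs′ _ = contradiction x≡hs′ (x≢h (n≤1+n s) (subst (suc s ≤_) (sym (+-suc s n)) (s≤s (m≤m+n s n))))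
... | tri> _ _ hs′<x with find-gap h (suc s) n x hs′<x (subst (λ k → x < h k) (+-suc s n) x<h)
                           (λ {j} s<j j≤ → x≢h (<⇒≤ s<j) (subst (j ≤_) (sym (+-suc s n)) j≤))
...   | i , lo , hi = suc i , subst (λ k → h k < x × x < h (suc k)) (sym (+-suc s (toℕ i))) (lo , hi)

-- t counts the gaps still inside runs, and X is L^(2^(number of runs − 1)).
cliqueBound : ℕ → ℕ → ℕ
cliqueBound zero    X = X * 1
cliqueBound (suc t) X = X * suc (2 * (suc t * cliqueBound t (X * X)))

module Runs {E : Set} (ℓ : ℕ) (pos : E → ℕ → ℕ)
            (pos-mono : ∀ e {j k} → j < k → k ≤ suc ℓ → pos e j < pos e k)
            (pos-disjoint : ∀ {e f} → e ≢ f → ∀ {j k} → j ≤ suc ℓ → k ≤ suc ℓ → pos e j ≢ pos f k) where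

  pos-mono-≤ : ∀ e {j k} → j ≤ k → k ≤ suc ℓ → pos e j ≤ pos e k
  pos-mono-≤ e j≤k k≤ with m≤n⇒m<n∨m≡n j≤k
  ... | inj₁ j<k  = <⇒≤ (pos-mono e j<k k≤)
  ... | inj₂ refl = ≤-refl

  -- A run is a block start, …, start + gaps of vertex indices; the last vertex of an edge, of
  -- index suc ℓ, belongs to no run.
  record Run : Set where
    field
      start gaps : ℕ
      bounded    : start + gaps ≤ ℓ
    stop : ℕ
    stop = start + gaps

    stop≤ : stop ≤ suc ℓ
    stop≤ = m≤n⇒m≤1+n bounded

    start≤stop : start ≤ stop
    start≤stop = m≤m+n start gaps

    start≤ : start ≤ suc ℓ
    start≤ = ≤-trans start≤stop stop≤

  open Run

  -- Vertices of an edge increase, so comparing the end of one block with the start of the other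
  -- places a whole block before another. The sign `false` is the same relation with the edges
  -- exchanged.
  Before : Run × Bool → Rel E 0ℓ
  Before (R , true)  e f = pos e (stop R) < pos f (start R)
  Before (R , false) e f = pos f (stop R) < pos e (start R)

  Before? : ∀ ρ → Decidable₂ (Before ρ)
  Before? (R , true)  e f = _ <? _
  Before? (R , false) e f = _ <? _

  Before-trans : ∀ ρ → Transitive (Before ρ)
  Before-trans (R , true)  {j = f} p q = <-trans p (≤-<-trans (pos-mono-≤ f (start≤stop R) (stop≤ R)) q)
  Before-trans (R , false) {j = f} p q = <-trans q (≤-<-trans (pos-mono-≤ f (start≤stop R) (stop≤ R)) p)

  Aligned : List (Run × Bool) → Rel E 0ℓ
  Aligned σ e f = All (λ ρ → Before ρ e f) σ

  Aligned-trans : ∀ σ → Transitive (Aligned σ)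
  Aligned-trans σ p q = All.zipWith (λ { {ρ} (a , b) → Before-trans ρ a b }) (p , q)

  signings : List Run → List (List (Run × Bool))
  signings []       = [] ∷ []
  signings (R ∷ Rs) = map ((R , true) ∷_) (signings Rs) ++ map ((R , false) ∷_) (signings Rs)

  length-signings : ∀ Rs → length (signings Rs) ≡ 2 ^ length Rs
  length-signings []       = refl
  length-signings (R ∷ Rs) = begin
    length (signings (R ∷ Rs))                       ≡⟨ length-++ (map _ (signings Rs)) ⟩
    length (map _ (signings Rs)) + _                 ≡⟨ cong₂ _+_ (length-map _ (signings Rs)) (length-map _ (signings Rs)) ⟩
    length (signings Rs) + length (signings Rs)      ≡⟨ cong (λ k → k + k) (length-signings Rs) ⟩
    2 ^ length Rs + 2 ^ length Rs                    ≡⟨ cong (2 ^ length Rs +_) (+-identityʳ _) ⟨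
    2 ^ length (R ∷ Rs)                              ∎
    where open ≡-Reasoning

  signing-of : ∀ {Rs R σ} → σ ∈ signings Rs → R ∈ Rs → ∃ λ s → (R , s) ∈ σ
  signing-of {S ∷ Rs} σ∈ R∈ with ∈-++⁻ (map ((S , true) ∷_) (signings Rs)) σ∈
  ... | inj₁ σ∈ with ∈-map⁻ _ σ∈
  signing-of σ∈ (here refl) | inj₁ _ | τ , τ∈ , refl = true , here refl
  signing-of σ∈ (there R∈)  | inj₁ _ | τ , τ∈ , refl with signing-of τ∈ R∈
  ... | s , ρ∈ = s , there ρ∈
  signing-of {S ∷ Rs} σ∈ R∈ | inj₂ σ∈′ with ∈-map⁻ _ σ∈′
  signing-of σ∈ (here refl) | inj₂ _ | τ , τ∈ , refl = false , here refl
  signing-of σ∈ (there R∈)  | inj₂ _ | τ , τ∈ , refl with signing-of τ∈ R∈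
  ... | s , ρ∈ = s , there ρ∈

  Overlap : Run → Rel E 0ℓ
  Overlap R e f = ¬ Before (R , true) e f × ¬ Before (R , false) e f

  Overlap-sym : ∀ {R e f} → Overlap R e f → Overlap R f e
  Overlap-sym (p , q) = q , p

  -- If no run overlaps, the comparisons made run by run spell out a signing.
  overlap-or-aligned : ∀ Rs e f → Any (λ R → Overlap R e f) Rs ⊎ ∃ λ σ → σ ∈ signings Rs × Aligned σ e f
  overlap-or-aligned []       e f = inj₂ ([] , here refl , [])
  overlap-or-aligned (R ∷ Rs) e f
    with overlap-or-aligned Rs e f | Before? (R , true) e f | Before? (R , false) e f
  ... | inj₁ o | _ | _ = inj₁ (there o)
  ... | inj₂ (σ , σ∈ , al) | yes b | _ = inj₂ (_ , ∈-++⁺ˡ (∈-map⁺ _ σ∈) , b ∷ al)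
  ... | inj₂ (σ , σ∈ , al) | no _  | yes b = inj₂ (_ , ∈-++⁺ʳ (map _ (signings Rs)) (∈-map⁺ _ σ∈) , b ∷ al)
  ... | inj₂ _ | no p | no q = inj₁ (here (p , q))

  -- Gaps, and vertices that fall into them

  Gap : List Run → Set
  Gap = Any (λ R → Fin (gaps R))

  firstRun : ∀ R Rs → Fin (gaps R) → Gap (R ∷ Rs)
  firstRun R Rs = here

  laterRun : ∀ R Rs → Gap Rs → Gap (R ∷ Rs)
  laterRun R Rs = there

  gapList : ∀ Rs → List (Gap Rs)
  gapList []       = []
  gapList (R ∷ Rs) = map (firstRun R Rs) (allFin (gaps R)) ++ map (laterRun R Rs) (gapList Rs)

  slack : List Run → ℕ
  slack Rs = sum (map gaps Rs)

  length-gapList : ∀ Rs → length (gapList Rs) ≡ slack Rs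
  length-gapList []       = refl
  length-gapList (R ∷ Rs) = trans (length-++ (map (firstRun R Rs) (allFin (gaps R))))
    (cong₂ _+_ (trans (length-map (firstRun R Rs) (allFin (gaps R))) (length-tabulate {n = gaps R} (λ i → i)))
               (trans (length-map (laterRun R Rs) (gapList Rs)) (length-gapList Rs)))

  -- The first vertex of `e` in the run falls into the gap of `f`. For fixed `e` this vertex is a
  -- point common to the gaps of all such `f`, and they can be cut there.
  Hits : ∀ {Rs} → Gap Rs → Rel E 0ℓ
  Hits {R ∷ _} (here i)  e f = pos f (start R + toℕ i) < pos e (start R) × pos e (start R) < pos f (suc (start R + toℕ i))
  Hits         (there g) e f = Hits g e f

  Hits? : ∀ {Rs} (g : Gap Rs) → Decidable₂ (Hits g)
  Hits? {R ∷ _} (here i)  e f = (_ <? _) ×-dec (_ <? _)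
  Hits?         (there g) e f = Hits? g e f

  Hits-some : ∀ Rs → Rel E 0ℓ
  Hits-some Rs e f = Any (λ g → Hits g e f) (gapList Rs)

  private
    hits-here : ∀ {R} Rs {e f} → e ≢ f → pos e (start R) < pos f (start R) → pos f (start R) ≤ pos e (stop R) →
                Hits-some (R ∷ Rs) f e
    hits-here {R} Rs {e} {f} e≢f lo hi
      with find-gap (pos e) (start R) (gaps R) (pos f (start R)) lo
             (≤∧≢⇒< hi (≢-sym (pos-disjoint e≢f (stop≤ R) (start≤ R))))
             (λ _ j≤ → ≢-sym (pos-disjoint e≢f (≤-trans j≤ (stop≤ R)) (start≤ R)))
    ... | i , h = lose (∈-++⁺ˡ (∈-map⁺ (firstRun R Rs) (∈-allFin i))) h

  -- Of two intervals that meet, the one starting later starts inside the other; as distinct edges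
  -- share no vertex, it starts strictly within a gap.
  overlap-hits : ∀ Rs {e f} → e ≢ f → Any (λ R → Overlap R e f) Rs → Hits-some Rs e f ⊎ Hits-some Rs f e
  overlap-hits (R ∷ Rs) {e} {f} e≢f (here (p , q)) with <-cmp (pos e (start R)) (pos f (start R))
  ... | tri< lt _ _ = inj₂ (hits-here Rs e≢f lt (≮⇒≥ p))
  ... | tri≈ _ eq _ = contradiction eq (pos-disjoint e≢f (start≤ R) (start≤ R))
  ... | tri> _ _ gt = inj₁ (hits-here Rs (≢-sym e≢f) gt (≮⇒≥ q))
  overlap-hits (R ∷ Rs) e≢f (there o) with overlap-hits Rs e≢f o
  ... | inj₁ h with find h
  ...   | g , g∈ , h′ = inj₁ (lose (∈-++⁺ʳ (map (firstRun R Rs) (allFin (gaps R))) (∈-map⁺ (laterRun R Rs) g∈)) h′)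
  overlap-hits (R ∷ Rs) e≢f (there o) | inj₂ h with find h
  ...   | g , g∈ , h′ = inj₂ (lose (∈-++⁺ʳ (map (firstRun R Rs) (allFin (gaps R))) (∈-map⁺ (laterRun R Rs) g∈)) h′)

  -- Cutting a run at a gap

  module _ (R : Run) (i : Fin (gaps R)) where

    private
      right-stop : suc (start R + toℕ i) + (gaps R ∸ suc (toℕ i)) ≡ stop R
      right-stop = trans (cong (_+ (gaps R ∸ suc (toℕ i))) (sym (+-suc (start R) (toℕ i))))
                   (trans (+-assoc (start R) _ _) (cong (start R +_) (m+[n∸m]≡n (toℕ<n i))))

    leftRun rightRun : Run
    leftRun = record { start = start R ; gaps = toℕ i
                     ; bounded = ≤-trans (+-monoʳ-≤ (start R) (<⇒≤ (toℕ<n i))) (bounded R) }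
    rightRun = record { start = suc (start R + toℕ i) ; gaps = gaps R ∸ suc (toℕ i)
                      ; bounded = subst (_≤ ℓ) (sym right-stop) (bounded R) }

    stop-left≤ : stop leftRun ≤ stop R
    stop-left≤ = +-monoʳ-≤ (start R) (<⇒≤ (toℕ<n i))

    stop-right≡ : stop rightRun ≡ stop R
    stop-right≡ = right-stop

    start≤start-right : start R ≤ start rightRun
    start≤start-right = m≤n⇒m≤1+n (m≤m+n _ _)

  -- Lists of runs are ordered from right to left.
  cut : ∀ Rs → Gap Rs → List Run
  cut (R ∷ Rs) (here i)  = rightRun R i ∷ leftRun R i ∷ Rs
  cut (R ∷ Rs) (there g) = R ∷ cut Rs g

  length-cut : ∀ Rs g → length (cut Rs g) ≡ suc (length Rs)
  length-cut (R ∷ Rs) (here i)  = refl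
  length-cut (R ∷ Rs) (there g) = cong suc (length-cut Rs g)

  -- The gap of the cut belongs to neither piece. This count is the recursion parameter of
  -- `erdős–szekeres`.
  slack-cut : ∀ Rs g → suc (slack (cut Rs g)) ≡ slack Rs
  slack-cut (R ∷ Rs) (here i)  = begin
    suc (gaps R ∸ suc (toℕ i) + (toℕ i + slack Rs))  ≡⟨ regroup (gaps R ∸ suc (toℕ i)) (toℕ i) (slack Rs) ⟩
    suc (toℕ i) + (gaps R ∸ suc (toℕ i)) + slack Rs  ≡⟨ cong (_+ slack Rs) (m+[n∸m]≡n (toℕ<n i)) ⟩
    gaps R + slack Rs                                ∎
    where
    open ≡-Reasoning
    regroup : ∀ a b c → suc (a + (b + c)) ≡ suc b + a + c
    regroup = solve-∀
  slack-cut (R ∷ Rs) (there g) = trans (sym (+-suc (gaps R) _)) (cong (gaps R +_) (slack-cut Rs g))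

  Covers : List Run → Set
  Covers Rs = ∀ {j} → j ≤ ℓ → Any (λ R → start R ≤ j × j ≤ stop R) Rs

  cut-covers : ∀ Rs g → Covers Rs → Covers (cut Rs g)
  cut-covers Rs g cov j≤ = go Rs g (cov j≤)
    where
    go : ∀ Rs g {j} → Any (λ R → start R ≤ j × j ≤ stop R) Rs → Any (λ R → start R ≤ j × j ≤ stop R) (cut Rs g)
    go (R ∷ Rs) (here i) {j} (here (lo , hi)) with j ≤? start R + toℕ i
    ... | yes j≤i = there (here (lo , j≤i))
    ... | no  j≰i = here (≰⇒> j≰i , subst (j ≤_) (sym (stop-right≡ R i)) hi)
    go (R ∷ Rs) (here i)  (there a) = there (there a)
    go (R ∷ Rs) (there g) (here a)  = here a
    go (R ∷ Rs) (there g) (there a) = there (go Rs g a)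

  -- The two edges are quantified independently, so that the order of vertices in different runs
  -- does not depend on their edges.
  LeftOf : List E → Run → Run → Set
  LeftOf xs S R = ∀ {e f} → e ∈ xs → f ∈ xs → pos e (stop S) < pos f (start R)

  Separated : List E → List Run → Set
  Separated xs = AllPairs (λ R S → LeftOf xs S R)

  Separated-resp : ∀ {xs ys Rs} → (∀ {e} → e ∈ ys → e ∈ xs) → Separated xs Rs → Separated ys Rs
  Separated-resp ⊂ = AllPairs.map (λ {R} {S} (sep : LeftOf _ S R) {e} {f} e∈ f∈ → sep (⊂ e∈) (⊂ f∈))

  private
    cut-right : ∀ {xs} {R : Run} Rs g → All (λ S → LeftOf xs S R) Rs → All (λ S → LeftOf xs S R) (cut Rs g)
    cut-right {R = R} (S ∷ Rs) (here i) (l ∷ ls) =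
      (λ {e} {f} e∈ f∈ → subst (λ k → pos e k < pos f (start R)) (sym (stop-right≡ S i)) (l e∈ f∈)) ∷
      (λ {e} {f} e∈ f∈ → ≤-<-trans (pos-mono-≤ e (stop-left≤ S i) (stop≤ S)) (l e∈ f∈)) ∷ ls
    cut-right {R = R} (S ∷ Rs) (there g) (l ∷ ls) = l ∷ cut-right {R = R} Rs g ls

  -- One vertex of `x` lies in the gap of every edge of `xs`: all left pieces end before it, and all
  -- right pieces start after it.
  cut-separated : ∀ {xs x} Rs g → All (Hits g x) xs → Separated xs Rs → Separated xs (cut Rs g)
  cut-separated (R ∷ Rs) (here i) hits (l ∷ ls) =
    ((λ e∈ f∈ → <-trans (proj₁ (All.lookup hits e∈)) (proj₂ (All.lookup hits f∈))) ∷
     All.map (λ sep {e} {f} e∈ f∈ → <-≤-trans (sep e∈ f∈)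
       (pos-mono-≤ f (start≤start-right R i) (start≤ (rightRun R i)))) l) ∷
    l ∷ ls
  cut-separated (R ∷ Rs) (there g) hits (l ∷ ls) = cut-right {R = R} Rs g l ∷ cut-separated Rs g hits ls

  -- The Erdős-Szekeres argument

  -- The rightmost run has the fixed sign `true`: reversing a chain flips all signs, so b runs have
  -- only 2^(b-1) orientations to consider. It is also the only run whose order relative to the last
  -- vertices is left open.
  record Clique (xs : List E) (k : ℕ) : Set where
    field
      lastRun   : Run
      runs      : List Run
      signing   : List (Run × Bool)
      signing∈  : signing ∈ signings runs
      covers    : Covers (lastRun ∷ runs)
      chain     : Chain (Aligned ((lastRun , true) ∷ signing)) xs k
      separated : Separated (Chain.elems chain) (lastRun ∷ runs)

  Clique-resp-⊆ : ∀ {xs ys k} → ys ⊆ xs → Clique ys k → Clique xs k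
  Clique-resp-⊆ τ c = record
    { lastRun = lastRun ; runs = runs ; signing = signing ; signing∈ = signing∈ ; covers = covers
    ; chain = Chain-resp-⊆ τ chain ; separated = separated }
    where open Clique c

  module _ (L : ℕ) where

    private
      square : ∀ b → L ^ (2 ^ suc b) ≡ L ^ (2 ^ b) * L ^ (2 ^ b)
      square b = trans (cong (λ k → L ^ (2 ^ b + k)) (+-identityʳ (2 ^ b))) (^-distribˡ-+-* L (2 ^ b) (2 ^ b))

      -- The edges left by `mirskys` are aligned under no signing, hence any two overlap in some
      -- run. An overlap is a hit in one direction or the other, and `tournament` finds an edge that
      -- hits more than `k` edges.
      chain-or-hits : ∀ k R Rs xs → Unique xs → Covers (R ∷ Rs) → Separated xs (R ∷ Rs) →
                      L ^ (2 ^ length Rs) * suc (2 * k) < length xs →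
                      Clique xs (suc L) ⊎
                      ∃ λ x → ∃ λ ys → ys ⊆ xs × k < length ys × All (Hits-some (R ∷ Rs) x) ys
      chain-or-hits k R Rs xs uniq cov sep lt
        with mirskys (λ σ x y → All.all? (λ ρ → Before? ρ x y) ((R , true) ∷ σ)) (signings Rs)
               (All.tabulate λ {σ} _ → Aligned-trans ((R , true) ∷ σ)) L (suc (2 * k)) xs
               (subst (λ j → L ^ j * _ < length xs) (sym (length-signings Rs)) lt)
      ... | inj₁ (σ , σ∈ , ch) = inj₁ (record
              { lastRun = R ; runs = Rs ; signing = σ ; signing∈ = σ∈ ; covers = cov ; chain = ch
              ; separated = Separated-resp (All.lookup (Chain.members ch)) sep })
      ... | inj₂ (ys , ys⊆ , k<ys , avoid)
        with tournament (λ x y → Any.any? (λ g → Hits? g x y) (gapList (R ∷ Rs))) k ys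
               (pairs ⊆-refl (AllPairs-resp-⊆ ys⊆ uniq)) k<ys
        where
        meet : ∀ {x y} → x ∈ ys → y ∈ ys → Any (λ S → Overlap S x y) (R ∷ Rs)
        meet {x} {y} x∈ y∈ with Before? (R , true) x y | Before? (R , false) x y
        ... | no p  | no q = here (p , q)
        ... | yes b | _ with overlap-or-aligned Rs x y
        ...   | inj₁ o = there o
        ...   | inj₂ (σ , σ∈ , al) = contradiction (b ∷ al) (All.lookup avoid σ∈ x∈ y∈)
        -- The sign `false` in the last run is the sign `true` for the pair read backwards.
        meet {x} {y} x∈ y∈ | no _ | yes b with overlap-or-aligned Rs y x
        ...   | inj₁ o = there (Any.map (λ {S} → Overlap-sym {S}) o)
        ...   | inj₂ (σ , σ∈ , al) = contradiction (b ∷ al) (All.lookup avoid σ∈ y∈ x∈)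
        pairs : ∀ {zs} → zs ⊆ ys → Unique zs →
                AllPairs (λ x y → Hits-some (R ∷ Rs) x y ⊎ Hits-some (R ∷ Rs) y x) zs
        pairs τ []                 = []
        pairs τ (_∷_ {z} {zs} n u) =
          All.tabulate (λ {w} w∈ → overlap-hits (R ∷ Rs) (All.lookup n w∈)
                                     (meet (lookup τ (here refl)) (lookup τ (there w∈)))) ∷
          pairs (⊆-trans (z ∷ʳ ⊆-refl) τ) u
      ...   | x , x∈ , k<hits = inj₂ (x , _ , ⊆-trans (filter-⊆ _ ys) ys⊆ , k<hits , All.all-filter _ ys)

    -- Induction on the number `t` of gaps. If one edge hits many, then a constant fraction of these
    -- is hit in the same gap; cutting there spends a gap and adds a run, which squares L^(2^b).
    erdős–szekeres : ∀ t b Rs xs → slack Rs ≡ t → length Rs ≡ suc b → Unique xs → Covers Rs → Separated xs Rs →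
                     cliqueBound t (L ^ (2 ^ b)) < length xs → Clique xs (suc L)
    erdős–szekeres zero b (R ∷ Rs) xs sl refl uniq cov sep lt with chain-or-hits 0 R Rs xs uniq cov sep lt
    ... | inj₁ c = c
    -- Without gaps there is nothing to hit, so this case is void.
    ... | inj₂ (x , y ∷ ys , _ , _ , h ∷ _) with gapList (R ∷ Rs) | trans (length-gapList (R ∷ Rs)) sl | h
    ...   | [] | _ | ()
    erdős–szekeres (suc t) b (R ∷ Rs) xs sl refl uniq cov sep lt
      with chain-or-hits (suc t * cliqueBound t (L ^ (2 ^ b) * L ^ (2 ^ b))) R Rs xs uniq cov sep lt
    ... | inj₁ c = c
    ... | inj₂ (x , ys , ys⊆ , k<ys , hits)
      with colour-pigeonhole (λ g → Hits? g x) (gapList (R ∷ Rs)) (cliqueBound t (L ^ (2 ^ b) * L ^ (2 ^ b)))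
             ys hits (subst (λ j → j * _ < length ys) (sym (trans (length-gapList (R ∷ Rs)) sl)) k<ys)
    ...   | g , _ , k<zs = Clique-resp-⊆ zs⊆xs
              (erdős–szekeres t (suc b) (cut (R ∷ Rs) g) zs
                (suc-injective (trans (slack-cut (R ∷ Rs) g) sl)) (length-cut (R ∷ Rs) g)
                (AllPairs-resp-⊆ zs⊆xs uniq) (cut-covers (R ∷ Rs) g cov)
                (cut-separated (R ∷ Rs) g (All.all-filter (Hits? g x) ys) (Separated-resp (lookup zs⊆xs) sep))
                (subst (λ X → cliqueBound t X < length zs) (sym (square b)) k<zs))
      where
      zs = filter (Hits? g x) ys
      zs⊆xs : zs ⊆ xs
      zs⊆xs = ⊆-trans (filter-⊆ _ ys) ys⊆

-- Lists split in two, and sizes of filtered lists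

AllPairs-map-All : {P : Pred A 0ℓ} {R S : Rel A 0ℓ} → (∀ {x y} → P x → P y → R x y → S x y) →
                   ∀ {xs} → All P xs → AllPairs R xs → AllPairs S xs
AllPairs-map-All f []       []       = []
AllPairs-map-All f (p ∷ ps) (r ∷ rs) = All.zipWith (λ (py , rxy) → f p py rxy) (ps , r) ∷ AllPairs-map-All f ps rs

AllPairs-take-drop : {R : Rel A 0ℓ} → ∀ k {xs} → AllPairs R xs → ∀ {x y} → x ∈ take k xs → y ∈ drop k xs → R x y
AllPairs-take-drop (suc k) {_ ∷ xs} (r ∷ rs) (here refl) y∈ = All.lookup r (lookup (drop-⊆ k xs) y∈)
AllPairs-take-drop (suc k) (r ∷ rs) (there x∈) y∈ = AllPairs-take-drop k rs x∈ y∈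

module _ {P Q : Pred A 0ℓ} (P? : Decidable P) (Q? : Decidable Q) (P⊆Q : ∀ {x} → P x → Q x) where

  length-filter-mono : ∀ xs → length (filter P? xs) ≤ length (filter Q? xs)
  length-filter-mono []       = z≤n
  length-filter-mono (x ∷ xs) with P? x | Q? x
  ... | yes _ | yes _ = s≤s (length-filter-mono xs)
  ... | yes p | no ¬q = contradiction (P⊆Q p) ¬q
  ... | no _  | yes _ = m≤n⇒m≤1+n (length-filter-mono xs)
  ... | no _  | no _  = length-filter-mono xs

  length-filter-strict : ∀ {x xs} → x ∈ xs → Q x → ¬ P x → length (filter P? xs) < length (filter Q? xs)
  length-filter-strict {xs = x ∷ xs} (here refl) qx ¬px with P? x | Q? x
  ... | yes p | _     = contradiction p ¬px
  ... | no _  | yes _ = s≤s (length-filter-mono xs)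
  ... | no _  | no ¬q = contradiction qx ¬q
  length-filter-strict {xs = z ∷ xs} (there x∈) qx ¬px with P? z | Q? z
  ... | yes _ | yes _ = s≤s (length-filter-strict x∈ qx ¬px)
  ... | yes p | no ¬q = contradiction (P⊆Q p) ¬q
  ... | no _  | yes _ = m≤n⇒m≤1+n (length-filter-strict x∈ qx ¬px)
  ... | no _  | no _  = length-filter-strict x∈ qx ¬px

-- The argument of Bukh and Rudenko: ranks and buckets

_∈ₚ_ : A → A × A → Set
x ∈ₚ (a , b) = x ≡ a ⊎ x ≡ b

module PermutationTwins {E : Set} (_≺_ : Rel E 0ℓ) (_≺?_ : Decidable₂ _≺_) (≺-trans : Transitive _≺_)
                        (≺-irrefl : ∀ {e} → ¬ e ≺ e) (q : E → ℕ) (q-injective : ∀ {e f} → q e ≡ q f → e ≡ f) where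

  -- `Parallel` compares corresponding entries only; `Apart` compares all four, and thereby also
  -- keeps the two pairs disjoint.
  Parallel Apart : Rel (E × E) 0ℓ
  Parallel (a , b) (a′ , b′) = (a ≺ a′ × b ≺ b′) ⊎ (a′ ≺ a × b′ ≺ b)
  Apart P P′ = (∀ {x y} → x ∈ₚ P → y ∈ₚ P′ → q x < q y) ⊎ (∀ {x y} → x ∈ₚ P → y ∈ₚ P′ → q y < q x)

  module _ (xs : List E) where

    rank : E → ℕ
    rank e = length (filter (λ f → q f <? q e) xs)

    rank-mono : ∀ {e f} → q e ≤ q f → rank e ≤ rank f
    rank-mono {e} {f} e≤f = length-filter-mono (λ g → q g <? q e) (λ g → q g <? q f) (λ lt → <-≤-trans lt e≤f) xs

    rank-strict : ∀ {e f} → e ∈ xs → q e < q f → rank e < rank f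
    rank-strict {e} {f} e∈ e<f =
      length-filter-strict (λ g → q g <? q e) (λ g → q g <? q f) (λ lt → <-trans lt e<f) e∈ e<f (<-irrefl refl)

    rank-injective : ∀ {e f} → e ∈ xs → f ∈ xs → rank e ≡ rank f → e ≡ f
    rank-injective {e} {f} e∈ f∈ eq with <-cmp (q e) (q f)
    ... | tri< e<f _ _ = contradiction eq (<⇒≢ (rank-strict e∈ e<f))
    ... | tri≈ _ e≡f _ = q-injective e≡f
    ... | tri> _ _ f<e = contradiction (sym eq) (<⇒≢ (rank-strict f∈ f<e))

    module _ (b : ℕ) .{{_ : NonZero b}} where

      -- Ranks, unlike the values of `q`, are bounded by the length of `xs`, so few buckets suffice.
      bucket : E → ℕ
      bucket e = rank e / b

      bucket-mono : ∀ {e f} → q e ≤ q f → bucket e ≤ bucket f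
      bucket-mono e≤f = /-monoˡ-≤ b (rank-mono e≤f)

      bucket≤ : ∀ B → length xs ≤ B * b → ∀ e → bucket e ≤ B
      bucket≤ B xs≤ e = ≤-trans (/-monoˡ-≤ b (≤-trans (length-filter _ xs) xs≤)) (≤-reflexive (m*n/n≡m B b))

      bucket-< : ∀ {e f} → bucket e < bucket f → q e < q f
      bucket-< lt = ≰⇒> λ f≤e → <⇒≱ lt (bucket-mono f≤e)

      -- In a fixed bucket the remainder modulo `b` determines the rank, and the rank determines the
      -- element of `xs`.
      bucket-size : ∀ c {ys} → ys ⊆ xs → Unique ys → length (filter (λ e → bucket e ≟ c) ys) ≤ b
      bucket-size c {ys} ys⊆ uniq = ≮⇒≥ λ b<zs → absurd (colour-pigeonhole (λ d e → rank e % b ≟ d) (upTo b) 1 zs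
          (All.tabulate λ {e} _ → lose (∈-upTo⁺ (m%n<n (rank e) b)) refl)
          (subst (_< length zs) (sym (trans (*-identityʳ _) (length-upTo b))) b<zs))
        where
        zs = filter (λ e → bucket e ≟ c) ys
        absurd : ¬ (∃ λ d → d ∈ upTo b × 1 < length (filter (λ e → rank e % b ≟ d) zs))
        absurd (d , _ , lt) with filter (λ e → rank e % b ≟ d) zs in eq
                               | AllPairs.filter⁺ (λ e → rank e % b ≟ d) (AllPairs.filter⁺ (λ e → bucket e ≟ c) uniq)
        ... | x ∷ y ∷ ws | (x≢y ∷ _) ∷ _ = x≢y (rank-injective (in-xs (here refl)) (in-xs (there (here refl)))
                (trans (decompose (here refl)) (sym (decompose (there (here refl))))))
          where
          both : ∀ {e} → e ∈ x ∷ y ∷ ws → e ∈ zs × rank e % b ≡ d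
          both e∈ = ∈-filter⁻ (λ e → rank e % b ≟ d) {xs = zs} (subst (_ ∈_) (sym eq) e∈)
          in-xs : ∀ {e} → e ∈ x ∷ y ∷ ws → e ∈ xs
          in-xs e∈ = lookup ys⊆ (proj₁ (∈-filter⁻ (λ e → bucket e ≟ c) {xs = ys} (proj₁ (both e∈))))
          decompose : ∀ {e} → e ∈ x ∷ y ∷ ws → rank e ≡ d + c * b
          decompose {e} e∈ = trans (m≡m%n+[m/n]*n (rank e) b)
            (cong₂ (λ r k → r + k * b) (proj₂ (both e∈))
                   (proj₂ (∈-filter⁻ (λ e → bucket e ≟ c) {xs = ys} (proj₁ (both e∈)))))
        absurd (d , _ , s≤s ()) | _ ∷ [] | _
        absurd (d , _ , ()) | [] | _

  -- Triples in common buckets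

  Triple : Set
  Triple = E × E × E

  part : Fin 3 → Triple → E
  part zero             (x , y , z) = x
  part (suc zero)       (x , y , z) = y
  part (suc (suc zero)) (x , y , z) = z

  module _ (β : E → ℕ) (β-mono : ∀ {e f} → q e ≤ q f → β e ≤ β f) where

    -- Meant for a list sorted by `q`, which is cut into blocks of three. As `β` is monotone,
    -- comparing the two ends decides whether a block lies in one bucket.
    triples : List E → List Triple
    triples (x ∷ y ∷ z ∷ g) with β x ≟ β z
    ... | yes _ = (x , y , z) ∷ triples g
    ... | no  _ = triples g
    triples _ = []

    triples-members : ∀ g {t} → t ∈ triples g → ∀ i → part i t ∈ g
    triples-members (x ∷ y ∷ z ∷ g) t∈ i with β x ≟ β z
    triples-members (x ∷ y ∷ z ∷ g) (here refl) zero             | yes _ = here refl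
    triples-members (x ∷ y ∷ z ∷ g) (here refl) (suc zero)       | yes _ = there (here refl)
    triples-members (x ∷ y ∷ z ∷ g) (here refl) (suc (suc zero)) | yes _ = there (there (here refl))
    triples-members (x ∷ y ∷ z ∷ g) (there t∈) i | yes _ = there (there (there (triples-members g t∈ i)))
    triples-members (x ∷ y ∷ z ∷ g) t∈ i | no _ = there (there (there (triples-members g t∈ i)))

    QIncreasing : List E → Set
    QIncreasing = AllPairs (λ e f → q e < q f)

    triples-increasing : ∀ {g} → QIncreasing g → ∀ {t} → t ∈ triples g →
                         part zero t ≢ part (suc zero) t × part zero t ≢ part (suc (suc zero)) t ×
                         part (suc zero) t ≢ part (suc (suc zero)) t
    triples-increasing {x ∷ y ∷ z ∷ g} ((x<y ∷ x<z ∷ _) ∷ (y<z ∷ _) ∷ _ ∷ inc) t∈ with β x ≟ β z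
    triples-increasing {x ∷ y ∷ z ∷ g} ((x<y ∷ x<z ∷ _) ∷ (y<z ∷ _) ∷ _ ∷ inc) (here refl) | yes _ =
      (<⇒≢ x<y ∘ cong q) , (<⇒≢ x<z ∘ cong q) , (<⇒≢ y<z ∘ cong q)
    triples-increasing {x ∷ y ∷ z ∷ g} (_ ∷ _ ∷ _ ∷ inc) (there t∈) | yes _ = triples-increasing inc t∈
    triples-increasing {x ∷ y ∷ z ∷ g} (_ ∷ _ ∷ _ ∷ inc) t∈ | no _ = triples-increasing inc t∈

    triples-bucket : ∀ {g} → QIncreasing g → ∀ {t} → t ∈ triples g → ∀ i → β (part i t) ≡ β (part zero t)
    triples-bucket {x ∷ y ∷ z ∷ g} (_ ∷ _ ∷ _ ∷ inc) t∈ i with β x ≟ β z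
    triples-bucket {x ∷ y ∷ z ∷ g} _ (here refl) zero | yes _ = refl
    triples-bucket {x ∷ y ∷ z ∷ g} ((x<y ∷ _) ∷ (y<z ∷ _) ∷ _) (here refl) (suc zero) | yes x≡z =
      ≤-antisym (≤-trans (β-mono (<⇒≤ y<z)) (≤-reflexive (sym x≡z))) (β-mono (<⇒≤ x<y))
    triples-bucket {x ∷ y ∷ z ∷ g} _ (here refl) (suc (suc zero)) | yes x≡z = sym x≡z
    triples-bucket {x ∷ y ∷ z ∷ g} (_ ∷ _ ∷ _ ∷ inc) (there t∈) i | yes _ = triples-bucket inc t∈ i
    triples-bucket {x ∷ y ∷ z ∷ g} (_ ∷ _ ∷ _ ∷ inc) t∈ i | no _ = triples-bucket inc t∈ i

    triples-apart : ∀ {g} → QIncreasing g → AllPairs (λ t t′ → ∀ i j → q (part i t) < q (part j t′)) (triples g)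
    triples-apart {[]} _ = []
    triples-apart {_ ∷ []} _ = []
    triples-apart {_ ∷ _ ∷ []} _ = []
    triples-apart {x ∷ y ∷ z ∷ g} ((_ ∷ _ ∷ x<) ∷ (_ ∷ y<) ∷ z< ∷ inc) with β x ≟ β z
    ... | no  _ = triples-apart inc
    ... | yes _ = All.tabulate (λ { t′∈ zero             j → All.lookup x< (triples-members g t′∈ j)
                                  ; t′∈ (suc zero)       j → All.lookup y< (triples-members g t′∈ j)
                                  ; t′∈ (suc (suc zero)) j → All.lookup z< (triples-members g t′∈ j) })
                  ∷ triples-apart inc

    -- A triple is lost only when β grows.
    length-triples : ∀ {g} → QIncreasing g → ∀ c k → All (λ e → c ≤ β e) g → All (λ e → β e ≤ c + k) g →
                     length g ≤ 3 * length (triples g) + 3 * k + 2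
    length-triples {[]} _ c k _ _ = z≤n
    length-triples {_ ∷ []} _ c k _ _ = ≤-trans (n≤1+n 1) (m≤n+m 2 (3 * k))
    length-triples {_ ∷ _ ∷ []} _ c k _ _ = m≤n+m 2 (3 * k)
    length-triples {x ∷ y ∷ z ∷ g} ((_ ∷ x<z ∷ _) ∷ _ ∷ z< ∷ inc) c k (c≤x ∷ _ ∷ _ ∷ c≤) (_ ∷ _ ∷ z≤ ∷ ≤k) with β x ≟ β z
    ... | yes _ = subst (3 + length g ≤_) (sym (three+ (length (triples g)) k)) (+-monoʳ-≤ 3 (length-triples inc c k c≤ ≤k))
      where
      three+ : ∀ t k → 3 * suc t + 3 * k + 2 ≡ 3 + (3 * t + 3 * k + 2)
      three+ = solve-∀
    ... | no x≢z = dropped k z≤ ≤k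
      where
      c<z : c < β z
      c<z = ≤-<-trans c≤x (≤∧≢⇒< (β-mono (<⇒≤ x<z)) x≢z)
      dropped : ∀ k → β z ≤ c + k → All (λ e → β e ≤ c + k) g → 3 + length g ≤ 3 * length (triples g) + 3 * k + 2
      dropped zero    z≤ _  = contradiction (subst (β z ≤_) (+-identityʳ c) z≤) (<⇒≱ c<z)
      dropped (suc k) _  ≤k = subst (3 + length g ≤_) (sym (three+ (length (triples g)) k))
        (+-monoʳ-≤ 3 (length-triples inc (suc c) k
          (All.map (λ z<e → ≤-trans c<z (β-mono (<⇒≤ z<e))) z<)
          (All.map (λ {e} e≤ → subst (β e ≤_) (+-suc c k) e≤) ≤k)))
        where
        three+ : ∀ t k → 3 * t + 3 * suc k + 2 ≡ 3 + (3 * t + 3 * k + 2)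
        three+ = solve-∀

    Twin : List E → E × E → Set
    Twin xs (a , b) = a ∈ xs × b ∈ xs × a ≢ b × β a ≡ β b

    private
      Agree : Fin 3 × Fin 3 → Rel Triple 0ℓ
      Agree (i , j) t t′ = part i t ≺ part i t′ × part j t ≺ part j t′

      coordinatePairs : List (Fin 3 × Fin 3)
      coordinatePairs = (zero , suc zero) ∷ (zero , suc (suc zero)) ∷ (suc zero , suc (suc zero)) ∷ []

      comparable : ∀ {xs x y} → AllPairs _≺_ xs → x ∈ xs → y ∈ xs → q x < q y → x ≺ y ⊎ y ≺ x
      comparable ord x∈ y∈ x<y with AllPairs-lookup ord x∈ y∈
      ... | inj₁ refl = contradiction x<y (<-irrefl refl)
      ... | inj₂ c    = c

      -- Of three comparisons with two outcomes each, two agree.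
      two-agree : ∀ t t′ → (∀ i → part i t ≺ part i t′ ⊎ part i t′ ≺ part i t) →
                  ∃ λ ij → ij ∈ coordinatePairs × (Agree ij t t′ ⊎ Agree ij t′ t)
      two-agree t t′ cmp with cmp zero | cmp (suc zero) | cmp (suc (suc zero))
      ... | inj₁ p | inj₁ r | _      = _ , here refl , inj₁ (p , r)
      ... | inj₂ p | inj₂ r | _      = _ , here refl , inj₂ (p , r)
      ... | inj₁ p | _      | inj₁ s = _ , there (here refl) , inj₁ (p , s)
      ... | inj₂ p | _      | inj₂ s = _ , there (here refl) , inj₂ (p , s)
      ... | _      | inj₁ r | inj₁ s = _ , there (there (here refl)) , inj₁ (r , s)
      ... | _      | inj₂ r | inj₂ s = _ , there (there (here refl)) , inj₂ (r , s)

    -- By Mirsky for the three relations `Agree`, either two coordinates share a chain of `u + 1`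
    -- triples, or two triples remain that agree in no two coordinates, against `two-agree`.
    triple-twins : ∀ u xs g → AllPairs _≺_ xs → (∀ {e} → e ∈ g → e ∈ xs) → QIncreasing g →
                   u ^ 3 < length (triples g) →
                   ∃ λ ps → length ps ≡ suc u × All (Twin xs) ps × AllPairs (λ P P′ → Parallel P P′ × Apart P P′) ps
    triple-twins u xs g ord g⊂ inc lt
      with mirskys {R = Agree} (λ (i , j) t t′ → (_ ≺? _) ×-dec (_ ≺? _)) coordinatePairs
             (All.tabulate λ {(i , j)} _ {t} {t′} {t″} → tr i j {t} {t′} {t″}) u 1 (triples g)
             (subst (_< length (triples g)) (sym (*-identityʳ _)) lt)
      where
      tr : ∀ i j → Transitive (Agree (i , j))
      tr i j (p , q) (p′ , q′) = ≺-trans p p′ , ≺-trans q q′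
    ... | inj₂ (t ∷ t′ ∷ ts , ⊆T , _ , avoid)
      with two-agree t t′ (λ i → comparable ord (in-xs (here refl) i) (in-xs (there (here refl)) i) (q-below i))
      where
      in-xs : ∀ {s} → s ∈ t ∷ t′ ∷ ts → ∀ i → part i s ∈ xs
      in-xs s∈ i = g⊂ (triples-members g (lookup ⊆T s∈) i)
      q-below : ∀ i → q (part i t) < q (part i t′)
      q-below i = All.lookup (AllPairs.head (AllPairs-resp-⊆ ⊆T (triples-apart inc))) (here refl) i i
    ...   | ij , ij∈ , inj₁ ag = contradiction ag (All.lookup avoid ij∈ (here refl) (there (here refl)))
    ...   | ij , ij∈ , inj₂ ag = contradiction ag (All.lookup avoid ij∈ (there (here refl)) (here refl))
    triple-twins u xs g ord g⊂ inc lt | inj₂ (_ ∷ [] , _ , s≤s () , _)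
    triple-twins u xs g ord g⊂ inc lt | inj₁ ((i , j) , ij∈ , mkChain ts len mem chain) =
      map pair ts , trans (length-map pair ts) len ,
      All.map⁺ (All.map (λ {t} t∈ → g⊂ (triples-members g t∈ i) , g⊂ (triples-members g t∈ j) , distinct t∈ ,
                           trans (triples-bucket inc t∈ i) (sym (triples-bucket inc t∈ j))) mem) ,
      AllPairs.map⁺ (AllPairs-map-All related mem chain)
      where
      pair : Triple → E × E
      pair t = part i t , part j t
      distinct : ∀ {t} → t ∈ triples g → part i t ≢ part j t
      distinct t∈ = go ij∈ (triples-increasing inc t∈)
        where
        go : ∀ {i j t} → (i , j) ∈ coordinatePairs →
             part zero t ≢ part (suc zero) t × part zero t ≢ part (suc (suc zero)) t ×
             part (suc zero) t ≢ part (suc (suc zero)) t → part i t ≢ part j t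
        go (here refl)                 (p , _ , _) = p
        go (there (here refl))         (_ , p , _) = p
        go (there (there (here refl))) (_ , _ , p) = p
      component : ∀ {x t} → x ∈ₚ pair t → ∃ λ k → x ≡ part k t
      component (inj₁ eq) = i , eq
      component (inj₂ eq) = j , eq
      related : ∀ {t t′} → t ∈ triples g → t′ ∈ triples g → Agree (i , j) t t′ →
                Parallel (pair t) (pair t′) × Apart (pair t) (pair t′)
      related {t} {t′} t∈ t′∈ ag = inj₁ ag , apart (AllPairs-lookup (triples-apart inc) t∈ t′∈)
        where
        apart : t ≡ t′ ⊎ (∀ k l → q (part k t) < q (part l t′)) ⊎ (∀ k l → q (part k t′) < q (part l t)) →
                Apart (pair t) (pair t′)
        apart (inj₁ refl)        = contradiction (proj₁ ag) ≺-irrefl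
        apart (inj₂ (inj₁ t<t′)) = inj₁ λ x∈ y∈ → below (component x∈) (component y∈)
          where
          below : ∀ {x y} → (∃ λ k → x ≡ part k t) → (∃ λ l → y ≡ part l t′) → q x < q y
          below (k , refl) (l , refl) = t<t′ k l
        apart (inj₂ (inj₂ t′<t)) = inj₂ λ x∈ y∈ → below (component x∈) (component y∈)
          where
          below : ∀ {x y} → (∃ λ k → x ≡ part k t) → (∃ λ l → y ≡ part l t′) → q y < q x
          below (k , refl) (l , refl) = t′<t l k

    sortByQ : List E → List E
    sortByQ = Sort.sort (On.decTotalOrder ≤-decTotalOrder q)

    sortByQ-↭ : ∀ g → sortByQ g ↭ g
    sortByQ-↭ = Sort.sort-↭ (On.decTotalOrder ≤-decTotalOrder q)

    sortByQ-increasing : ∀ {g} → Unique g → QIncreasing (sortByQ g)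
    sortByQ-increasing {g} uniq = AllPairs.zipWith (λ (le , ne) → ≤∧≢⇒< le (ne ∘ q-injective))
      ( Linked⇒AllPairs ≤-trans (Sort.sort-↗ (On.decTotalOrder ≤-decTotalOrder q) g)
      , Unique-resp-↭ (setoid E) (↭⇒↭ₛ (↭-sym (sortByQ-↭ g))) uniq )

    -- Once the group is sorted by `q`, at most `3 * B + 2` of its edges lie outside the triples;
    -- hence there are more than u³ triples.
    group-twins : ∀ u B g → AllPairs _≺_ g → Unique g → All (λ e → β e ≤ B) g → 3 * u ^ 3 + 3 * B + 3 ≤ length g →
                  ∃ λ ps → length ps ≡ suc u × All (Twin g) ps × AllPairs (λ P P′ → Parallel P P′ × Apart P P′) ps
    group-twins u B g ord uniq β≤B len =
      triple-twins u g h ord (∈-resp-↭ (sortByQ-↭ g)) (sortByQ-increasing uniq)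
        (*-cancelˡ-< 3 _ _ (+-cancelʳ-< (3 * B + 2) _ _ (begin-strict
          3 * u ^ 3 + (3 * B + 2)             <⟨ ≤-reflexive (shift (3 * u ^ 3) (3 * B)) ⟩
          3 * u ^ 3 + 3 * B + 3               ≤⟨ len ⟩
          length g                            ≡⟨ ↭-length (sortByQ-↭ g) ⟨
          length h                            ≤⟨ length-triples (sortByQ-increasing uniq) 0 B (All.tabulate λ _ → z≤n)
                                                   (All.tabulate λ e∈ → All.lookup β≤B (∈-resp-↭ (sortByQ-↭ g) e∈)) ⟩
          3 * length (triples h) + 3 * B + 2  ≡⟨ +-assoc (3 * length (triples h)) _ _ ⟩
          3 * length (triples h) + (3 * B + 2) ∎)))
      where
      open ≤-Reasoning
      h = sortByQ g
      shift : ∀ a b → suc (a + (b + 2)) ≡ a + b + 3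
      shift = solve-∀

  -- Successive rounds in disjoint sets of buckets

  -- Here `w` is the size of a bucket, `B` bounds the bucket indices, `K` is the size of a group,
  -- and `D` bounds the number of edges in the `u + 1` buckets that the pairs of a group may occupy.
  module _ (base : List E) (ord : AllPairs _≺_ base) (uniq : Unique base)
           (u w B K D : ℕ) .{{_ : NonZero w}} (size : length base ≤ B * w)
           (group≤ : 3 * u ^ 3 + 3 * B + 3 ≤ K) (killed≤ : suc u * w ≤ D) where

    private
      -- Ranks are always taken in `base`, so the buckets stay the same while the list of remaining
      -- edges shrinks.
      β : E → ℕ
      β = bucket base w

      β-mono : ∀ {e f} → q e ≤ q f → β e ≤ β f
      β-mono = bucket-mono base w

      Related : Rel (E × E) 0ℓ
      Related P P′ = Parallel P P′ × Apart P P′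

      bucketOf : E × E → ℕ
      bucketOf (a , _) = β a

      Used : List (E × E) → Pred E 0ℓ
      Used ps e = Any (λ c → β e ≡ c) (map bucketOf ps)

      used? : ∀ ps → Decidable (Used ps)
      used? ps e = Any.any? (λ c → β e ≟ c) (map bucketOf ps)

      survivors : List (E × E) → List E → List E
      survivors ps ys = filter (∁? (used? ps)) (drop K ys)

      survivors⊆ : ∀ ps ys → survivors ps ys ⊆ ys
      survivors⊆ ps ys = ⊆-trans (filter-⊆ (∁? (used? ps)) (drop K ys)) (drop-⊆ K ys)

    -- One round spends a group of K edges and the at most D edges in the buckets it occupies.
    rounds : ∀ k ys → ys ⊆ base → k * (K + D) ≤ length ys →
             ∃ λ ps → k * u ≤ length ps × All (Twin β β-mono ys) ps × AllPairs Related ps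
    rounds zero    ys ys⊆ _   = [] , z≤n , [] , []
    rounds (suc k) ys ys⊆ len
      with group-twins β β-mono u B (take K ys)
             (AllPairs.take⁺ K (AllPairs-resp-⊆ ys⊆ ord))
             (AllPairs.take⁺ K (AllPairs-resp-⊆ ys⊆ uniq))
             (All.tabulate λ {e} _ → bucket≤ base w B size e)
             (≤-trans group≤ (≤-reflexive (sym (trans (length-take K ys)
               (m≤n⇒m⊓n≡m (m+n≤o⇒m≤o K (m+n≤o⇒m≤o (K + D) len)))))))
    ... | ps , len-ps , twins , related
      with rounds k (survivors ps ys) (⊆-trans (survivors⊆ ps ys) ys⊆) survivors-size
      where
      used≤ : length (filter (used? ps) (drop K ys)) ≤ D
      used≤ = ≮⇒≥ λ lt → absurd (colour-pigeonhole (λ c e → β e ≟ c) (map bucketOf ps) w zs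
                (All.all-filter (used? ps) (drop K ys))
                (≤-<-trans (≤-trans (≤-reflexive (cong (_* w) (trans (length-map bucketOf ps) len-ps))) killed≤) lt))
        where
        zs = filter (used? ps) (drop K ys)
        zs⊆ : zs ⊆ base
        zs⊆ = ⊆-trans (filter-⊆ (used? ps) (drop K ys)) (⊆-trans (drop-⊆ K ys) ys⊆)
        absurd : ¬ (∃ λ c → c ∈ map bucketOf ps × w < length (filter (λ e → β e ≟ c) zs))
        absurd (c , _ , lt) = <⇒≱ lt (bucket-size base w c zs⊆ (AllPairs-resp-⊆ zs⊆ uniq))
      survivors-size : k * (K + D) ≤ length (survivors ps ys)
      survivors-size = +-cancelˡ-≤ (K + D) _ _ (begin
        K + D + k * (K + D)
          ≤⟨ len ⟩
        length ys
          ≡⟨ cong length (take++drop≡id K ys) ⟨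
        length (take K ys ++ drop K ys)
          ≡⟨ length-++ (take K ys) ⟩
        length (take K ys) + length (drop K ys)
          ≤⟨ +-monoˡ-≤ _ (≤-trans (≤-reflexive (length-take K ys)) (m⊓n≤m K _)) ⟩
        K + length (drop K ys)
          ≡⟨ cong (K +_) (length-filter-∁ (used? ps) (drop K ys)) ⟨
        K + (length (filter (used? ps) (drop K ys)) + length (survivors ps ys))
          ≤⟨ +-monoʳ-≤ K (+-monoˡ-≤ _ used≤) ⟩
        K + (D + length (survivors ps ys))
          ≡⟨ +-assoc K D _ ⟨
        K + D + length (survivors ps ys)
          ∎)
        where open ≤-Reasoning
    ... | ps′ , len-ps′ , twins′ , related′ =
      ps ++ ps′ ,
      subst (u + k * u ≤_) (sym (length-++ ps)) (+-mono-≤ (≤-trans (n≤1+n u) (≤-reflexive (sym len-ps))) len-ps′) ,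
      All.++⁺ (All.map (λ (a∈ , b∈ , rest) → lookup (take-⊆ K ys) a∈ , lookup (take-⊆ K ys) b∈ , rest) twins)
              (All.map (λ (a∈ , b∈ , rest) → lookup (survivors⊆ ps ys) a∈ , lookup (survivors⊆ ps ys) b∈ , rest) twins′) ,
      AllPairs.++⁺ related related′ (All.tabulate λ P∈ → All.tabulate λ P′∈ → across P∈ P′∈)
      where
      across : ∀ {P P′} → P ∈ ps → P′ ∈ ps′ → Related P P′
      across {P@(a , b)} {P′@(a′ , b′)} P∈ P′∈ with All.lookup twins P∈ | All.lookup twins′ P′∈
      ... | a∈ , b∈ , _ , βa≡βb | a′∈ , b′∈ , _ , βa′≡βb′ =
        inj₁ (before a∈ a′∈ , before b∈ b′∈) , apart (<-cmp (β a) (β a′))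
        where
        dropped : ∀ {e} → e ∈ survivors ps ys → e ∈ drop K ys
        dropped = lookup (filter-⊆ (∁? (used? ps)) (drop K ys))
        before : ∀ {e f} → e ∈ take K ys → f ∈ survivors ps ys → e ≺ f
        before e∈ f∈ = AllPairs-take-drop K (AllPairs-resp-⊆ ys⊆ ord) e∈ (dropped f∈)
        fresh : β a ≢ β a′
        fresh eq = proj₂ (∈-filter⁻ (∁? (used? ps)) {xs = drop K ys} a′∈)
                     (lose (∈-map⁺ bucketOf P∈) (sym eq))
        in-P : ∀ {x} → x ∈ₚ P → β x ≡ β a
        in-P (inj₁ refl) = refl
        in-P (inj₂ refl) = sym βa≡βb
        in-P′ : ∀ {x} → x ∈ₚ P′ → β x ≡ β a′
        in-P′ (inj₁ refl) = refl
        in-P′ (inj₂ refl) = sym βa′≡βb′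
        apart : _ → Apart P P′
        apart (tri< lt _ _) = inj₁ λ x∈ y∈ → bucket-< base w (subst₂ _<_ (sym (in-P x∈)) (sym (in-P′ y∈)) lt)
        apart (tri≈ _ eq _) = contradiction eq fresh
        apart (tri> _ _ gt) = inj₂ λ x∈ y∈ → bucket-< base w (subst₂ _<_ (sym (in-P′ y∈)) (sym (in-P x∈)) gt)

  TwinFamily : List E → List (E × E) → Set
  TwinFamily xs ps = All (λ (a , b) → a ∈ xs × b ∈ xs × a ≢ b) ps × AllPairs (λ P P′ → Parallel P P′ × Apart P P′) ps

  private
    -- Keeping only the first `n` edges lets the number and the size of the buckets depend on `n`
    -- alone.
    truncated-rounds : ∀ xs → AllPairs _≺_ xs → Unique xs → ∀ u w B K D k n .{{_ : NonZero w}} →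
                       n ≤ B * w → 3 * u ^ 3 + 3 * B + 3 ≤ K → suc u * w ≤ D → k * (K + D) ≤ n → n ≤ length xs →
                       ∃ λ ps → k * u ≤ length ps × TwinFamily xs ps
    truncated-rounds xs ord uniq u w B K D k n n≤ group≤ killed≤ ≤n len
      with rounds (take n xs) (AllPairs.take⁺ n ord) (AllPairs.take⁺ n uniq) u w B K D
             (subst (_≤ B * w) (sym length-n) n≤) group≤ killed≤ k (take n xs) ⊆-refl
             (subst (k * (K + D) ≤_) (sym length-n) ≤n)
      where
      length-n : length (take n xs) ≡ n
      length-n = trans (length-take n xs) (m≤n⇒m⊓n≡m len)
    ... | ps , len-ps , twins , related =
      ps , len-ps ,
      All.map (λ (a∈ , b∈ , a≢b , _) → lookup (take-⊆ n xs) a∈ , lookup (take-⊆ n xs) b∈ , a≢b) twins , related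

  -- 36u⁵ = u² · (24u³ + 12u³): u² rounds, each yielding more than u pairs.
  bukh–rudenko : ∀ u xs → 1 ≤ u → AllPairs _≺_ xs → Unique xs → 36 * u ^ 5 ≤ length xs →
                 ∃ λ ps → u ^ 3 ≤ length ps × TwinFamily xs ps
  bukh–rudenko u xs 1≤u ord uniq len =
    Product.map₂ (λ {ps} → Product.map₁ (subst (_≤ length ps) (u²u≡u³ u)))
      -- There are 6u³ buckets of 6u² edges. A group needs 3u³ + 18u³ + 3 ≤ 24u³ edges, and its u +
      -- 1 buckets hold at most (u + 1) · 6u² ≤ 12u³; both inequalities use u ≥ 1.
      (truncated-rounds xs ord uniq u (6 * u ^ 2) (6 * u ^ 3) (24 * u ^ 3) (12 * u ^ 3) (u ^ 2) (36 * u ^ 5) {{w≢0}}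
        (≤-reflexive (bucket-product u)) group≤ killed≤ (≤-reflexive (rounds-product u)) len)
    where
    w≢0 : NonZero (6 * u ^ 2)
    w≢0 = m*n≢0 6 (u ^ 2) {{_}} {{m^n≢0 u 2 {{>-nonZero 1≤u}}}}
    u²u≡u³ : ∀ u → u ^ 2 * u ≡ u ^ 3
    u²u≡u³ = solve 1 (λ u → u :^ 2 :* u := u :^ 3) refl
    rounds-product : ∀ u → u ^ 2 * (24 * u ^ 3 + 12 * u ^ 3) ≡ 36 * u ^ 5
    rounds-product = solve 1 (λ u → u :^ 2 :* (con 24 :* u :^ 3 :+ con 12 :* u :^ 3) := con 36 :* u :^ 5) refl
    bucket-product : ∀ u → 36 * u ^ 5 ≡ 6 * u ^ 3 * (6 * u ^ 2)
    bucket-product = solve 1 (λ u → con 36 :* u :^ 5 := con 6 :* u :^ 3 :* (con 6 :* u :^ 2)) refl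
    group≤ : 3 * u ^ 3 + 3 * (6 * u ^ 3) + 3 ≤ 24 * u ^ 3
    group≤ = subst (3 * u ^ 3 + 3 * (6 * u ^ 3) + 3 ≤_) (total (u ^ 3))
               (+-monoʳ-≤ (3 * u ^ 3 + 3 * (6 * u ^ 3)) (*-monoʳ-≤ 3 (m^n>0 u {{>-nonZero 1≤u}} 3)))
      where
      total : ∀ c → 3 * c + 3 * (6 * c) + 3 * c ≡ 24 * c
      total = solve 1 (λ c → con 3 :* c :+ con 3 :* (con 6 :* c) :+ con 3 :* c := con 24 :* c) refl
    killed≤ : suc u * (6 * u ^ 2) ≤ 12 * u ^ 3
    killed≤ = subst (suc u * (6 * u ^ 2) ≤_) (total u) (*-monoˡ-≤ (6 * u ^ 2) (+-monoˡ-≤ u 1≤u))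
      where
      total : ∀ u → (u + u) * (6 * u ^ 2) ≡ 12 * u ^ 3
      total = solve 1 (λ u → (u :+ u) :* (con 6 :* u :^ 2) := con 12 :* u :^ 3) refl

-- Roots and inequalities between powers

crossover : {P : Pred ℕ 0ℓ} → Decidable P → ∀ n → P 0 → ¬ P n → ∃ λ u → P u × ¬ P (suc u)
crossover P? zero    p0 ¬p = contradiction p0 ¬p
crossover P? (suc n) p0 ¬p with P? n
... | yes p = n , p , ¬p
... | no ¬p′ = crossover P? n p0 ¬p′

-- This inverts `f` up to a factor 2 in the argument: u is chosen so that f(u + 1) already exceeds
-- `m`, and u + 1 ≤ 2u. The hypothesis `m < f (suc m)` bounds the search.
dyadic-inverse : ∀ (f : ℕ → ℕ) → (∀ {a b} → a ≤ b → f a ≤ f b) → ∀ m → f 1 ≤ m → m < f (suc m) →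
                 ∃ λ u → 1 ≤ u × f u ≤ m × m ≤ f (u + u)
dyadic-inverse f f-mono m f1≤m m<f with crossover (λ u → f (suc u) ≤? m) m f1≤m (<⇒≱ m<f)
... | u , fu≤m , ¬fu′≤m = suc u , s≤s z≤n , fu≤m ,
      ≤-trans (<⇒≤ (≰⇒> ¬fu′≤m)) (f-mono (s≤s (≤-trans (s≤s (m≤m+n u u)) (≤-reflexive (sym (+-suc u u))))))

^-distribʳ-* : ∀ m n k → (m * n) ^ k ≡ m ^ k * n ^ k
^-distribʳ-* m n zero    = refl
^-distribʳ-* m n (suc k) = trans (cong (m * n *_) (^-distribʳ-* m n k)) (interchange m n (m ^ k) (n ^ k))
  where
  interchange : ∀ a b c d → a * b * (c * d) ≡ a * c * (b * d)
  interchange = solve-∀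

m≤m^n : ∀ m n .{{_ : NonZero n}} → m ≤ m ^ n
m≤m^n zero      (suc n) = z≤n
m≤m^n m@(suc _) (suc n) = subst (_≤ m ^ suc n) (*-identityʳ m) (^-monoʳ-≤ m (s≤s (z≤n {n})))

-- 1152 = 36 · 2⁵
fifth-root : ∀ {c} → 1152 ≤ c → ∀ m → 36 ≤ m → ∃ λ u → 1 ≤ u × 36 * u ^ 5 ≤ m × m ≤ c * u ^ 5
fifth-root {c} 1152≤c m 36≤m = Product.map₂ (λ {u} → Product.map₂ (Product.map₂ (λ m≤ → ≤-trans m≤ (double u))))
    (dyadic-inverse (λ u → 36 * u ^ 5) (λ a≤b → *-monoʳ-≤ 36 (^-monoˡ-≤ 5 a≤b)) m 36≤m
      (≤-trans (m≤m^n (suc m) 5) (m≤n*m (suc m ^ 5) 36)))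
  where
  open ≤-Reasoning
  double : ∀ u → 36 * (u + u) ^ 5 ≤ c * u ^ 5
  double u = begin
    36 * (u + u) ^ 5        ≡⟨ cong (λ k → 36 * (u + k) ^ 5) (+-identityʳ u) ⟨
    36 * (2 * u) ^ 5        ≡⟨ cong (36 *_) (^-distribʳ-* 2 u 5) ⟩
    36 * (2 ^ 5 * u ^ 5)    ≡⟨ *-assoc 36 (2 ^ 5) (u ^ 5) ⟨
    36 * 2 ^ 5 * u ^ 5      ≤⟨ *-monoˡ-≤ (u ^ 5) 1152≤c ⟩
    c * u ^ 5               ∎

-- The bound s ≥ (m/c)^(3/5), in the form without roots that is used from here on.
cube-fifth : ∀ c u m s → m ≤ c * u ^ 5 → u ^ 3 ≤ s → m ^ 3 ≤ c ^ 3 * s ^ 5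
cube-fifth c u m s m≤ u³≤s = begin
  m ^ 3                ≤⟨ ^-monoˡ-≤ 3 m≤ ⟩
  (c * u ^ 5) ^ 3      ≡⟨ ^-distribʳ-* c (u ^ 5) 3 ⟩
  c ^ 3 * (u ^ 5) ^ 3  ≡⟨ cong (c ^ 3 *_) (trans (^-*-assoc u 5 3) (sym (^-*-assoc u 3 5))) ⟩
  c ^ 3 * (u ^ 3) ^ 5  ≤⟨ *-monoʳ-≤ (c ^ 3) (^-monoˡ-≤ 5 u³≤s) ⟩
  c ^ 3 * s ^ 5        ∎
  where open ≤-Reasoning

cube-scale : ∀ k c m x s → m ≤ k * x → x ^ 3 ≤ c ^ 3 * s → m ^ 3 ≤ (k * c) ^ 3 * s
cube-scale k c m x s m≤kx x≤ = begin
  m ^ 3                  ≤⟨ ^-monoˡ-≤ 3 m≤kx ⟩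
  (k * x) ^ 3            ≡⟨ ^-distribʳ-* k x 3 ⟩
  k ^ 3 * x ^ 3          ≤⟨ *-monoʳ-≤ (k ^ 3) x≤ ⟩
  k ^ 3 * (c ^ 3 * s)    ≡⟨ *-assoc (k ^ 3) (c ^ 3) s ⟨
  k ^ 3 * c ^ 3 * s      ≡⟨ cong (_* s) (^-distribʳ-* k c 3) ⟨
  (k * c) ^ 3 * s        ∎
  where open ≤-Reasoning

-- The ratio `a`/`b` stands in for the fifth root of `k`, which is irrational in the cases needed.
fifth-powers : ∀ a b k x y .{{_ : NonZero b}} → b ^ 5 * k ≤ a ^ 5 → a * x ≤ b * y → k * x ^ 5 ≤ y ^ 5
fifth-powers a b k x y bk≤a ax≤by = *-cancelˡ-≤ (b ^ 5) {{m^n≢0 b 5}} (begin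
  b ^ 5 * (k * x ^ 5)  ≡⟨ *-assoc (b ^ 5) k (x ^ 5) ⟨
  b ^ 5 * k * x ^ 5    ≤⟨ *-monoˡ-≤ (x ^ 5) bk≤a ⟩
  a ^ 5 * x ^ 5        ≡⟨ ^-distribʳ-* a x 5 ⟨
  (a * x) ^ 5          ≤⟨ ^-monoˡ-≤ 5 ax≤by ⟩
  (b * y) ^ 5          ≡⟨ ^-distribʳ-* b y 5 ⟩
  b ^ 5 * y ^ 5        ∎)
  where open ≤-Reasoning

-- The superadditivity behind the halving step: 4^(-3/5) + 2^(-3/5) > 1.
cube≤fifth-+ : ∀ C m l n s t → m ≤ 4 * l → m ≤ 2 * n → l ^ 3 ≤ C * s ^ 5 → n ^ 3 ≤ C * t ^ 5 →
               m ^ 3 ≤ C * (s + t) ^ 5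
-- The cases split at s : t = 3 : 5. In the first, s + t ≥ (8/5)t and (8/5)⁵ ≥ 8 = 2³; in the
-- second, s + t ≥ (8/3)s and (8/3)⁵ ≥ 64 = 4³.
cube≤fifth-+ C m l n s t m≤4l m≤2n l≤s n≤t with ≤-total (3 * t) (5 * s)
... | inj₁ 3t≤5s = begin
  m ^ 3              ≤⟨ ^-monoˡ-≤ 3 m≤2n ⟩
  (2 * n) ^ 3        ≡⟨ cube n ⟩
  8 * n ^ 3          ≤⟨ *-monoʳ-≤ 8 n≤t ⟩
  8 * (C * t ^ 5)    ≡⟨ swap-8 C (t ^ 5) ⟩
  C * (8 * t ^ 5)    ≤⟨ *-monoʳ-≤ C (fifth-powers 8 5 8 t (s + t) (≤ᵇ⇒≤ (5 ^ 5 * 8) (8 ^ 5) tt) 8t≤) ⟩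
  C * (s + t) ^ 5    ∎
  where
  open ≤-Reasoning
  cube : ∀ n → (2 * n) ^ 3 ≡ 8 * n ^ 3
  cube = solve 1 (λ n → (con 2 :* n) :^ 3 := con 8 :* n :^ 3) refl
  swap-8 : ∀ a b → 8 * (a * b) ≡ a * (8 * b)
  swap-8 = solve-∀
  8t≤ : 8 * t ≤ 5 * (s + t)
  8t≤ = subst₂ _≤_ (eq₁ t) (eq₂ s t) (+-monoˡ-≤ (5 * t) 3t≤5s)
    where
    eq₁ : ∀ t → 3 * t + 5 * t ≡ 8 * t
    eq₁ = solve-∀
    eq₂ : ∀ s t → 5 * s + 5 * t ≡ 5 * (s + t)
    eq₂ = solve-∀
... | inj₂ 5s≤3t = begin
  m ^ 3              ≤⟨ ^-monoˡ-≤ 3 m≤4l ⟩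
  (4 * l) ^ 3        ≡⟨ cube l ⟩
  64 * l ^ 3         ≤⟨ *-monoʳ-≤ 64 l≤s ⟩
  64 * (C * s ^ 5)   ≡⟨ swap-64 C (s ^ 5) ⟩
  C * (64 * s ^ 5)   ≤⟨ *-monoʳ-≤ C (fifth-powers 8 3 64 s (s + t) (≤ᵇ⇒≤ (3 ^ 5 * 64) (8 ^ 5) tt) 8s≤) ⟩
  C * (s + t) ^ 5    ∎
  where
  open ≤-Reasoning
  cube : ∀ n → (4 * n) ^ 3 ≡ 64 * n ^ 3
  cube = solve 1 (λ n → (con 4 :* n) :^ 3 := con 64 :* n :^ 3) refl
  swap-64 : ∀ a b → 64 * (a * b) ≡ a * (64 * b)
  swap-64 = solve-∀
  8s≤ : 8 * s ≤ 3 * (s + t)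
  8s≤ = subst₂ _≤_ (eq₁ s) (eq₂ s t) (+-monoʳ-≤ (3 * s) 5s≤3t)
    where
    eq₁ : ∀ s → 3 * s + 5 * s ≡ 8 * s
    eq₁ = solve-∀
    eq₂ : ∀ s t → 3 * s + 3 * t ≡ 3 * (s + t)
    eq₂ = solve-∀

-- Twins in a chain by halving

module Halving {E : Set} (lo hi q : E → ℕ) (lo≤hi : ∀ e → lo e ≤ hi e) (hi<q : ∀ e → hi e < q e)
               (q-injective : ∀ {e f} → q e ≡ q f → e ≡ f) (c : ℕ) (c-large : 1152 ≤ c) where

  _≺_ : Rel E 0ℓ
  e ≺ f = hi e < lo f

  ≺-irrefl : ∀ {e} → ¬ e ≺ e
  ≺-irrefl {e} e≺e = <⇒≱ e≺e (lo≤hi e)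

  ≺⇒≢ : ∀ {e f} → e ≺ f → e ≢ f
  ≺⇒≢ e≺f refl = ≺-irrefl e≺f

  open PermutationTwins _≺_ (λ e f → hi e <? lo f) (λ {_} {f} p r → <-trans p (≤-<-trans (lo≤hi f) r))
                   (λ {e} → ≺-irrefl {e}) q q-injective public

  -- `Clear P P′` keeps the last vertices of `P′` out of the last runs of `P`, on the same side for
  -- all of them. Under the four conditions of `Congruent`, every comparison of last runs and last
  -- vertices between the two pairs comes out alike in both coordinates.
  Clear Congruent : Rel (E × E) 0ℓ
  Clear P P′ = (∀ {x y} → x ∈ₚ P → y ∈ₚ P′ → hi x < q y) ⊎ (∀ {x y} → x ∈ₚ P → y ∈ₚ P′ → q y < lo x)
  Congruent P P′ = Parallel P P′ × Apart P P′ × Clear P P′ × Clear P′ P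

  Distinct : List E → E × E → Set
  Distinct xs (a , b) = a ∈ xs × b ∈ xs × a ≢ b

  ∈ₚ-Distinct : ∀ {xs P x} → Distinct xs P → x ∈ₚ P → x ∈ xs
  ∈ₚ-Distinct (a∈ , _ , _) (inj₁ refl) = a∈
  ∈ₚ-Distinct (_ , b∈ , _) (inj₂ refl) = b∈

  Distinct-resp-⊆ : ∀ {xs ys P} → ys ⊆ xs → Distinct ys P → Distinct xs P
  Distinct-resp-⊆ τ (a∈ , b∈ , a≢b) = lookup τ a∈ , lookup τ b∈ , a≢b

  module _ (xs : List E) (cross : ∀ {e f} → e ∈ xs → f ∈ xs → hi e < q f) where

    private
      crossing-congruent : ∀ {P P′} → Distinct xs P → Distinct xs P′ → Parallel P P′ × Apart P P′ → Congruent P P′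
      crossing-congruent {P} {P′} d d′ (par , ap) = par , ap ,
        inj₁ (λ x∈ y∈ → cross (∈ₚ-Distinct {P = P} d x∈) (∈ₚ-Distinct {P = P′} d′ y∈)) ,
        inj₁ (λ x∈ y∈ → cross (∈ₚ-Distinct {P = P′} d′ x∈) (∈ₚ-Distinct {P = P} d y∈))

    -- When every last vertex lies beyond every last run, `Clear` always holds, and the edges amount
    -- to a permutation given by the orders `≺` and `q`. The `u` for `bukh–rudenko` comes from
    -- `fifth-root`.
    crossing-twins : AllPairs _≺_ xs → 36 ≤ length xs →
                     ∃ λ ps → length xs ^ 3 ≤ c ^ 3 * length ps ^ 5 × All (Distinct xs) ps × AllPairs Congruent ps
    crossing-twins ord 36≤ = go (fifth-root c-large (length xs) 36≤)
      where
      go : (∃ λ u → 1 ≤ u × 36 * u ^ 5 ≤ length xs × length xs ≤ c * u ^ 5) →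
           ∃ λ ps → length xs ^ 3 ≤ c ^ 3 * length ps ^ 5 × All (Distinct xs) ps × AllPairs Congruent ps
      go (u , 1≤u , len , len≤) =
        Product.map₂ (λ {ps} → Product.map (cube-fifth c u (length xs) (length ps) len≤) λ (twins , related) →
            twins , AllPairs-map-All (λ {P} {P′} → crossing-congruent {P} {P′}) twins related)
          (bukh–rudenko u xs 1≤u ord (AllPairs.map ≺⇒≢ ord) len)

  module _ (C : ℕ) (C-large : (8 * c) ^ 3 ≤ C) where

    Family : List E → Set
    Family xs = ∃ λ ps → length xs ^ 3 ≤ C * length ps ^ 5 × All (Distinct xs) ps × AllPairs Congruent ps

    private
      -- The threshold is 288 = 8 · 36: in a longer chain, an eighth has the 36 edges that
      -- `crossing-twins` requires. Up to it, a single pair is enough.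
      small : ∀ m → m ≤ 288 → m ^ 3 ≤ C * 1
      small m m≤288 = begin
        m ^ 3        ≤⟨ ^-monoˡ-≤ 3 m≤8c ⟩
        (8 * c) ^ 3  ≤⟨ C-large ⟩
        C            ≡⟨ *-identityʳ C ⟨
        C * 1        ∎
        where
        open ≤-Reasoning
        m≤8c : m ≤ 8 * c
        m≤8c = ≤-trans (≤-trans m≤288 (m≤m+n 288 864)) (≤-trans c-large (m≤n*m c 8))

      one-pair : ∀ x y zs → AllPairs _≺_ (x ∷ y ∷ zs) → length (x ∷ y ∷ zs) ≤ 288 → Family (x ∷ y ∷ zs)
      one-pair x y zs ((x≺y ∷ _) ∷ _) len =
        (x , y) ∷ [] , small (length (x ∷ y ∷ zs)) len , (here refl , there (here refl) , ≺⇒≢ x≺y) ∷ [] , [] ∷ []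

      -- The second half is `y ∷ B`. The last vertices of far edges lie beyond all last runs of the
      -- first half, so that these edges form a permutation; those of near edges lie before all last
      -- runs of the second half.
      module Split (xs : List E) (ord : AllPairs _≺_ xs) (h : ℕ) (y : E) (B : List E) (eq : drop h xs ≡ y ∷ B) where

        front far near : List E
        front = take h xs
        far = filter (λ a → lo y ≤? q a) front
        near = filter (∁? (λ a → lo y ≤? q a)) front

        y∷B⊆ : y ∷ B ⊆ xs
        y∷B⊆ = subst (_⊆ xs) eq (drop-⊆ h xs)

        far⊆ : far ⊆ xs
        far⊆ = ⊆-trans (filter-⊆ _ front) (take-⊆ h xs)

        near⊆ : near ⊆ xs
        near⊆ = ⊆-trans (filter-⊆ _ front) (take-⊆ h xs)

        front≺ : ∀ {a b} → a ∈ front → b ∈ y ∷ B → a ≺ b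
        front≺ a∈ b∈ = AllPairs-take-drop h ord a∈ (subst (_ ∈_) (sym eq) b∈)

        lo-y≤ : ∀ {b} → b ∈ y ∷ B → lo y ≤ lo b
        lo-y≤ (here refl) = ≤-refl
        lo-y≤ (there b∈) = ≤-trans (lo≤hi y) (<⇒≤ (All.lookup (AllPairs.head (AllPairs-resp-⊆ y∷B⊆ ord)) b∈))

        far-crossing : ∀ {e f} → e ∈ far → f ∈ far → hi e < q f
        far-crossing e∈ f∈ = <-≤-trans (front≺ (lookup (filter-⊆ _ front) e∈) (here refl))
                                       (proj₂ (∈-filter⁻ (λ a → lo y ≤? q a) {xs = front} f∈))

        near-q : ∀ {a b} → a ∈ near → b ∈ y ∷ B → q a < lo b
        near-q a∈ b∈ = <-≤-trans (≰⇒> (proj₂ (∈-filter⁻ (∁? (λ a → lo y ≤? q a)) {xs = front} a∈))) (lo-y≤ b∈)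

        -- Last runs and last vertices of near edges all precede the last runs of the second half,
        -- which settles every comparison.
        join-congruent : ∀ {P P′} → Distinct near P → Distinct (y ∷ B) P′ → Congruent P P′
        join-congruent {P@(a , b)} {P′@(a′ , b′)} d d′ =
          inj₁ (≺ₚ (inj₁ refl) (inj₁ refl) , ≺ₚ (inj₂ refl) (inj₂ refl)) ,
          inj₁ (λ x∈ y∈ → <-trans (q< x∈ y∈) (≤-<-trans (lo≤hi _) (hi<q _))) ,
          inj₁ (λ x∈ y∈ → <-trans (≺ₚ x∈ y∈) (≤-<-trans (lo≤hi _) (hi<q _))) ,
          inj₂ (λ x∈ y∈ → q< y∈ x∈)
          where
          ≺ₚ : ∀ {x y} → x ∈ₚ P → y ∈ₚ P′ → x ≺ y
          ≺ₚ x∈ y∈ = front≺ (lookup (filter-⊆ _ front) (∈ₚ-Distinct {P = P} d x∈)) (∈ₚ-Distinct {P = P′} d′ y∈)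
          q< : ∀ {x y} → x ∈ₚ P → y ∈ₚ P′ → q x < lo y
          q< x∈ y∈ = near-q (∈ₚ-Distinct {P = P} d x∈) (∈ₚ-Distinct {P = P′} d′ y∈)

        length-split : length far + length near + length (y ∷ B) ≡ length xs
        length-split = trans (cong₂ _+_ (length-filter-∁ (λ a → lo y ≤? q a) front) (cong length (sym eq)))
                       (trans (sym (length-++ front)) (cong length (take++drop≡id h xs)))

        join : length xs ≤ 4 * length near → length xs ≤ 2 * length (y ∷ B) → Family near → Family (y ∷ B) → Family xs
        join m≤4l m≤2n (ps , p≤ , pd , pc) (rs , r≤ , rd , rc) =
          ps ++ rs ,
          subst (λ k → length xs ^ 3 ≤ C * k ^ 5) (sym (length-++ ps)) (cube≤fifth-+ C (length xs) (length near) (length (y ∷ B)) (length ps) (length rs) m≤4l m≤2n p≤ r≤) ,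
          All.++⁺ (All.map (λ {P} → Distinct-resp-⊆ {P = P} near⊆) pd) (All.map (λ {P} → Distinct-resp-⊆ {P = P} y∷B⊆) rd) ,
          AllPairs.++⁺ pc rc (All.map (λ {P} d → All.map (λ {P′} d′ → join-congruent {P} {P′} d d′) rd) pd)

        cross : 36 ≤ length far → length xs ≤ 8 * length far → Family xs
        cross 36≤ m≤8x =
          Product.map₂ (λ {ps} → Product.map (enlarge (length ps ^ 5)) (Product.map₁ (All.map λ {P} → Distinct-resp-⊆ {P = P} far⊆)))
            (crossing-twins far far-crossing (AllPairs-resp-⊆ far⊆ ord) 36≤)
          where
          -- The factor 8 in `(8 * c) ^ 3` pays for passing to the far edges, at least an eighth of
          -- the chain.
          enlarge : ∀ s → length far ^ 3 ≤ c ^ 3 * s → length xs ^ 3 ≤ C * s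
          enlarge s p≤ = ≤-trans (cube-scale 8 c (length xs) (length far) s m≤8x p≤) (*-monoˡ-≤ s C-large)

      drop-nonempty : ∀ h (xs : List E) → h < length xs → ∃ λ y → ∃ λ B → drop h xs ≡ y ∷ B
      drop-nonempty zero    (x ∷ xs) _        = x , xs , refl
      drop-nonempty (suc h) (x ∷ xs) (s≤s lt) = drop-nonempty h xs lt

      -- The first half has at least (m - 1)/2 edges, of which fewer than m/8 are far, and (m - 1)/2
      -- - m/8 ≥ m/4 once m ≥ 4.
      near-large : ∀ m x l b → x + l + b ≡ m → b ≤ suc (x + l) → 4 ≤ m → 8 * x < m → m ≤ 4 * l
      near-large m x l b refl b≤ 4≤m 8x<m = *-cancelˡ-≤ 2 (+-cancelʳ-≤ (8 * x + 4) _ _ (begin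
        2 * m + (8 * x + 4)       ≤⟨ +-monoʳ-≤ (2 * m) (+-mono-≤ (<⇒≤ 8x<m) 4≤m) ⟩
        2 * m + (m + m)           ≡⟨ regroup x l b ⟩
        4 * (x + l) + 4 * b       ≤⟨ +-monoʳ-≤ (4 * (x + l)) (*-monoʳ-≤ 4 b≤) ⟩
        4 * (x + l) + 4 * suc (x + l)  ≡⟨ regroup′ x l ⟩
        2 * (4 * l) + (8 * x + 4) ∎))
        where
        open ≤-Reasoning
        regroup : ∀ x l b → 2 * (x + l + b) + (x + l + b + (x + l + b)) ≡ 4 * (x + l) + 4 * b
        regroup = solve-∀
        regroup′ : ∀ x l → 4 * (x + l) + 4 * suc (x + l) ≡ 2 * (4 * l) + (8 * x + 4)
        regroup′ = solve-∀

      -- Recursion on a bound for the length. If at least an eighth of the chain is far, these edges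
      -- suffice. Otherwise at least a quarter is near, and twins there are joined to twins in the
      -- second half, with `cube≤fifth-+` for the sizes.
      halving : ∀ fuel xs → length xs ≤ fuel → 2 ≤ length xs → AllPairs _≺_ xs → Family xs
      halving _          (_ ∷ [])         _    (s≤s ()) _
      halving (suc fuel) xs@(x ∷ y₀ ∷ zs) len≤ 2≤ ord with length xs ≤? 288
      ... | yes m≤288 = one-pair x y₀ zs ord m≤288
      ... | no  m≰288 with drop-nonempty ⌊ length xs /2⌋ xs (⌊n/2⌋<n (suc (length zs)))
      ... | y , B , eq = decide (length xs ≤? 8 * length far)
        where
        open Split xs ord ⌊ length xs /2⌋ y B eq
        m = length xs
        m>288 : 288 < m
        m>288 = ≰⇒> m≰288
        length-front : length far + length near ≡ ⌊ m /2⌋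
        length-front = trans (length-filter-∁ (λ a → lo y ≤? q a) front) (trans (length-take ⌊ m /2⌋ xs) (m≤n⇒m⊓n≡m (⌊n/2⌋≤n m)))
        length-B : length (y ∷ B) ≡ ⌈ m /2⌉
        length-B = +-cancelˡ-≡ ⌊ m /2⌋ _ _ (trans (cong (_+ length (y ∷ B)) (sym length-front)) (trans length-split (sym (⌊n/2⌋+⌈n/2⌉≡n m))))
        ⌈n/2⌉≤1+⌊n/2⌋ : ∀ n → ⌈ n /2⌉ ≤ suc ⌊ n /2⌋
        ⌈n/2⌉≤1+⌊n/2⌋ zero          = z≤n
        ⌈n/2⌉≤1+⌊n/2⌋ (suc zero)    = ≤-refl
        ⌈n/2⌉≤1+⌊n/2⌋ (suc (suc n)) = s≤s (⌈n/2⌉≤1+⌊n/2⌋ n)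
        m≤2B : m ≤ 2 * length (y ∷ B)
        m≤2B = begin
          m                      ≡⟨ ⌊n/2⌋+⌈n/2⌉≡n m ⟨
          ⌊ m /2⌋ + ⌈ m /2⌉      ≤⟨ +-mono-≤ (⌊n/2⌋≤⌈n/2⌉ m) (≤-reflexive (sym (+-identityʳ _))) ⟩
          2 * ⌈ m /2⌉            ≡⟨ cong (2 *_) length-B ⟨
          2 * length (y ∷ B)     ∎ where open ≤-Reasoning
        at-least-2 : ∀ k {j} → 288 < k * j → k ≤ 8 → 2 ≤ j
        at-least-2 k {j} lt k≤8 = ≰⇒> λ j≤1 →
          <⇒≱ lt (≤-trans (*-mono-≤ k≤8 j≤1) (m≤m+n 8 280))
        B<m : length (y ∷ B) ≤ fuel
        B<m = subst (_≤ fuel) (sym length-B) (≤-trans (⌊n/2⌋<n (length zs)) (≤-pred len≤))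
        near<m : length near ≤ fuel
        near<m = ≤-trans (m≤n+m (length near) (length far)) (≤-trans (≤-reflexive length-front)
                   (≤-trans (⌊n/2⌋≤⌈n/2⌉ m) (≤-trans (≤-reflexive (sym length-B)) B<m)))
        decide : Dec (m ≤ 8 * length far) → Family xs
        decide (yes m≤8x) = cross (*-cancelˡ-≤ 8 (<⇒≤ (<-≤-trans m>288 m≤8x))) m≤8x
        decide (no  m≰8x) = join m≤4l m≤2B
            (halving fuel near near<m (at-least-2 4 (<-≤-trans m>288 m≤4l) (m≤m+n 4 4)) (AllPairs-resp-⊆ near⊆ ord))
            (halving fuel (y ∷ B) B<m (at-least-2 2 (<-≤-trans m>288 m≤2B) (m≤m+n 2 6)) (AllPairs-resp-⊆ y∷B⊆ ord))
          where
          m≤4l : m ≤ 4 * length near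
          m≤4l = near-large m (length far) (length near) (length (y ∷ B)) length-split
                   (subst₂ _≤_ (sym length-B) (cong suc (sym length-front)) (⌈n/2⌉≤1+⌊n/2⌋ m))
                   (≤-trans (m≤m+n 4 284) (<⇒≤ m>288)) (≰⇒> m≰8x)

    run-twins : ∀ xs → 2 ≤ length xs → AllPairs _≺_ xs → Family xs
    run-twins xs = halving (length xs) xs ≤-refl

-- Finite subsets and increasing lists

module _ {n : ℕ} where

  fromList : List (Fin n) → Subset n
  fromList []       = ⊥
  fromList (x ∷ xs) = ⁅ x ⁆ ∪ fromList xs

  ∈-fromList⁺ : ∀ {x xs} → x ∈ xs → x ∈ˢ fromList xs
  ∈-fromList⁺ {x} (here refl) = x∈p∪q⁺ (inj₁ (x∈⁅x⁆ x))
  ∈-fromList⁺     (there x∈)  = x∈p∪q⁺ (inj₂ (∈-fromList⁺ x∈))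

  ∈-fromList⁻ : ∀ {x} xs → x ∈ˢ fromList xs → x ∈ xs
  ∈-fromList⁻ []       x∈ = contradiction x∈ ∉⊥
  ∈-fromList⁻ (y ∷ xs) x∈ with x∈p∪q⁻ ⁅ y ⁆ (fromList xs) x∈
  ... | inj₁ x∈y = here (x∈⁅y⁆⇒x≡y y x∈y)
  ... | inj₂ x∈′ = there (∈-fromList⁻ xs x∈′)

  length≤∣fromList∣ : ∀ {xs} → Unique xs → length xs ≤ ∣ fromList xs ∣
  length≤∣fromList∣ {[]}     []         = z≤n
  length≤∣fromList∣ {x ∷ xs} (x∉ ∷ uniq) = ≤-<-trans (length≤∣fromList∣ uniq)
    (p⊂q⇒∣p∣<∣q∣ ((λ y∈ → x∈p∪q⁺ (inj₂ y∈)) ,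
      x , x∈p∪q⁺ (inj₁ (x∈⁅x⁆ x)) , λ x∈ → All.lookup x∉ (∈-fromList⁻ xs x∈) refl))

-- nth xs i = 0 for i ≥ length xs.
nth : List ℕ → ℕ → ℕ
nth []       _       = 0
nth (x ∷ xs) zero    = x
nth (x ∷ xs) (suc i) = nth xs i

nth-∈ : ∀ xs {i} → i < length xs → nth xs i ∈ xs
nth-∈ (x ∷ xs) {zero}  _        = here refl
nth-∈ (x ∷ xs) {suc i} (s≤s i<) = there (nth-∈ xs i<)

nth-mono : ∀ {xs} → AllPairs _<_ xs → ∀ {i j} → i < j → j < length xs → nth xs i < nth xs j
nth-mono {x ∷ xs} (x< ∷ inc) {zero}  {suc j} _         (s≤s j<) = All.lookup x< (nth-∈ xs j<)
nth-mono {x ∷ xs} (x< ∷ inc) {suc i} {suc j} (s≤s i<j) (s≤s j<) = nth-mono inc i<j j<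

nth-lookup : ∀ {m} (xs : List (Fin m)) i → toℕ (List.lookup xs i) ≡ nth (map toℕ xs) (toℕ i)
nth-lookup (x ∷ xs) zero    = refl
nth-lookup (x ∷ xs) (suc i) = nth-lookup xs i

-- Vertices of a matching as an edge with an index

module Positions {r n : ℕ} (M : OrderedMatching r n) where

  vertices : Fin n → List (Fin (r * n))
  vertices e = filter (λ v → edgeOf M v ≟ᶠ e) (allFin (r * n))

  pos : Fin n → ℕ → ℕ
  pos e = nth (map toℕ (vertices e))

  private
    length-positions : ∀ e → length (map toℕ (vertices e)) ≡ r
    length-positions e = trans (length-map toℕ (vertices e)) (edgeSize M e)

  pos-mono : ∀ e {j k} → j < k → k < r → pos e j < pos e k
  pos-mono e {k = k} j<k k<r = nth-mono increasing j<k (subst (k <_) (sym (length-positions e)) k<r)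
    where
    increasing : AllPairs _<_ (map toℕ (vertices e))
    increasing = AllPairs.map⁺ (AllPairs.filter⁺ (λ v → edgeOf M v ≟ᶠ e) (AllPairs.tabulate⁺-< {f = id} id))

  private
    pos-vertex : ∀ e {j} → j < r → ∃ λ v → edgeOf M v ≡ e × toℕ v ≡ pos e j
    pos-vertex e {j} j<r with ∈-map⁻ toℕ (nth-∈ (map toℕ (vertices e)) (subst (j <_) (sym (length-positions e)) j<r))
    ... | v , v∈ , eq = v , proj₂ (∈-filter⁻ (λ v → edgeOf M v ≟ᶠ e) {xs = allFin (r * n)} v∈) , sym eq

  pos-disjoint : ∀ {e f} → e ≢ f → ∀ {j k} → j < r → k < r → pos e j ≢ pos f k
  pos-disjoint {e} {f} e≢f j<r k<r eq with pos-vertex e j<r | pos-vertex f k<r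
  ... | v , refl , v≡ | w , refl , w≡ =
    e≢f (cong (edgeOf M) (toℕ-injective (trans v≡ (trans eq (sym w≡)))))

  vert : Fin n → Fin r → Fin (r * n)
  vert e i = List.lookup (vertices e) (cast (sym (edgeSize M e)) i)

  toℕ-vert : ∀ e i → toℕ (vert e i) ≡ pos e (toℕ i)
  toℕ-vert e i = trans (nth-lookup (vertices e) _) (cong (pos e) (toℕ-cast (sym (edgeSize M e)) i))

  edgeOf-vert : ∀ e i → edgeOf M (vert e i) ≡ e
  edgeOf-vert e i = proj₂ (∈-filter⁻ (λ v → edgeOf M v ≟ᶠ e) {xs = allFin (r * n)} (∈-lookup {xs = vertices e} _))

  private
    own : ∀ v → v ∈ vertices (edgeOf M v)
    own v = ∈-filter⁺ (λ w → edgeOf M w ≟ᶠ edgeOf M v) (∈-allFin v) refl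

  index : Fin (r * n) → Fin r
  index v = cast (edgeSize M (edgeOf M v)) (Any.index (own v))

  vert-index : ∀ v → vert (edgeOf M v) (index v) ≡ v
  vert-index v = trans (cong (List.lookup (vertices (edgeOf M v)))
                         (cast-involutive (sym (edgeSize M (edgeOf M v))) (edgeSize M (edgeOf M v)) (Any.index (own v))))
                       (sym (lookup-index (own v)))

  toℕ-pos : ∀ v → toℕ v ≡ pos (edgeOf M v) (toℕ (index v))
  toℕ-pos v = trans (cong toℕ (sym (vert-index v))) (toℕ-vert (edgeOf M v) (index v))

  same-pos : ∀ {e i j} → vert e i ≡ vert e j → pos e (toℕ i) ≡ pos e (toℕ j)
  same-pos {e} {i} {j} eq = trans (sym (toℕ-vert e i)) (trans (cong toℕ eq) (toℕ-vert e j))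

  vert-injective : ∀ e {i j} → vert e i ≡ vert e j → i ≡ j
  vert-injective e {i} {j} eq with <-cmp (toℕ i) (toℕ j)
  ... | tri< lt _ _ = contradiction (same-pos eq) (<⇒≢ (pos-mono e lt (toℕ<n j)))
  ... | tri≈ _ i≡j _ = toℕ-injective i≡j
  ... | tri> _ _ gt = contradiction (same-pos eq) (≢-sym (<⇒≢ (pos-mono e gt (toℕ<n i))))

  index-vert : ∀ e i → index (vert e i) ≡ i
  index-vert e i = vert-injective e
    (trans (cong (λ f → vert f (index (vert e i))) (sym (edgeOf-vert e i))) (vert-index (vert e i)))

  -- From pairs of edges to twins

  -- An edge that comes first in no pair is sent to itself, a default outside the twin `S`.
  mate : List (Fin n × Fin n) → Fin n → Fin n
  mate []             e = e
  mate ((a , b) ∷ ps) e with e ≟ᶠ a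
  ... | yes _ = b
  ... | no  _ = mate ps e

  mate-∈ : ∀ ps {e} → e ∈ map proj₁ ps → (e , mate ps e) ∈ ps
  mate-∈ ((a , b) ∷ ps) {e} e∈ with e ≟ᶠ a
  ... | yes refl = here refl
  ... | no  e≢a  with e∈
  ...   | here refl = contradiction refl e≢a
  ...   | there e∈′ = there (mate-∈ ps e∈′)

  ∈ₚ-≢ : Rel (Fin n × Fin n) 0ℓ
  ∈ₚ-≢ P P′ = ∀ {x y} → x ∈ₚ P → y ∈ₚ P′ → x ≢ y

  module _ (ps : List (Fin n × Fin n)) (a≢b : All (λ (a , b) → a ≢ b) ps) (apart : AllPairs ∈ₚ-≢ ps)
           (sync : ∀ {a b a′ b′} → (a , b) ∈ ps → (a′ , b′) ∈ ps → ∀ {j k} → j < r → k < r →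
                   pos a j < pos a′ k → pos b j < pos b′ k) where

    private
      same-pair : ∀ {P P′ x} → P ∈ ps → P′ ∈ ps → x ∈ₚ P → x ∈ₚ P′ → P ≡ P′
      same-pair P∈ P′∈ x∈ x∈′ with AllPairs-lookup apart P∈ P′∈
      ... | inj₁ eq = eq
      ... | inj₂ (inj₁ ap) = contradiction refl (ap x∈ x∈′)
      ... | inj₂ (inj₂ ap) = contradiction refl (ap x∈′ x∈)

      firsts seconds : List (Fin n)
      firsts  = map proj₁ ps
      seconds = map proj₂ ps

      shift : Fin (r * n) → Fin (r * n)
      shift v = vert (mate ps (edgeOf M v)) (index v)

      edgeOf-shift : ∀ v → edgeOf M (shift v) ≡ mate ps (edgeOf M v)
      edgeOf-shift v = edgeOf-vert (mate ps (edgeOf M v)) (index v)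

      pair-of : ∀ {v} → edgeOf M v ∈ˢ fromList firsts → (edgeOf M v , mate ps (edgeOf M v)) ∈ ps
      pair-of v∈ = mate-∈ ps (∈-fromList⁻ firsts v∈)

      maps-into : ∀ v → edgeOf M v ∈ˢ fromList firsts → edgeOf M (shift v) ∈ˢ fromList seconds
      maps-into v v∈ = subst (_∈ˢ fromList seconds) (sym (edgeOf-shift v)) (∈-fromList⁺ (∈-map⁺ proj₂ (pair-of v∈)))

      disjoint : ∀ e → ¬ (e ∈ˢ fromList firsts × e ∈ˢ fromList seconds)
      disjoint e (e∈S , e∈T) with ∈-map⁻ proj₁ (∈-fromList⁻ firsts e∈S) | ∈-map⁻ proj₂ (∈-fromList⁻ seconds e∈T)
      ... | (_ , b) , P∈ , refl | (a , _) , P′∈ , refl with same-pair P∈ P′∈ (inj₁ refl) (inj₂ refl)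
      ...   | refl = All.lookup a≢b P∈ refl

      onto : ∀ w → edgeOf M w ∈ˢ fromList seconds → Σ (Fin (r * n)) λ v → edgeOf M v ∈ˢ fromList firsts × shift v ≡ w
      onto w w∈ with edgeOf M w in w-edge | ∈-map⁻ proj₂ (∈-fromList⁻ seconds w∈)
      ... | _ | (a , b) , P∈ , refl = vert a (index w) ,
          subst (_∈ˢ fromList firsts) (sym (edgeOf-vert a (index w))) (∈-fromList⁺ (∈-map⁺ proj₁ P∈)) ,
          (begin
            vert (mate ps (edgeOf M (vert a (index w)))) (index (vert a (index w)))
              ≡⟨ cong₂ (λ e i → vert (mate ps e) i) (edgeOf-vert a (index w)) (index-vert a (index w)) ⟩
            vert (mate ps a) (index w)
              ≡⟨ cong (λ e → vert e (index w)) (trans mate-a (sym w-edge)) ⟩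
            vert (edgeOf M w) (index w)
              ≡⟨ vert-index w ⟩
            w ∎)
        where
        open ≡-Reasoning
        mate-a : mate ps a ≡ b
        mate-a = cong proj₂ (same-pair (mate-∈ ps (∈-map⁺ proj₁ P∈)) P∈ (inj₁ refl) (inj₁ refl))

      monotone : ∀ u v → edgeOf M u ∈ˢ fromList firsts → edgeOf M v ∈ˢ fromList firsts → u <ᶠ v → shift u <ᶠ shift v
      monotone u v u∈ v∈ u<v = subst₂ _<_ (sym (toℕ-vert _ (index u))) (sym (toℕ-vert _ (index v)))
        (sync (pair-of u∈) (pair-of v∈) (toℕ<n (index u)) (toℕ<n (index v)) (subst₂ _<_ (toℕ-pos u) (toℕ-pos v) u<v))

      unmate : ∀ {u v} → edgeOf M u ∈ˢ fromList firsts → edgeOf M v ∈ˢ fromList firsts →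
               edgeOf M (shift u) ≡ edgeOf M (shift v) → edgeOf M u ≡ edgeOf M v
      unmate {u} {v} u∈ v∈ eq = cong proj₁ (same-pair (pair-of u∈) (pair-of v∈) (inj₂ refl)
        (inj₂ (trans (sym (edgeOf-shift u)) (trans eq (edgeOf-shift v)))))

    -- The vertex of index j in a first edge goes to the vertex of index j in its mate, so `sync` is
    -- monotonicity. Disjointness of the pairs, with `a≢b`, separates `S` from `T`; it also makes
    -- the first edges distinct, which gives the size.
    twins-from-pairs : Σ (Twins M) λ tw → length ps ≤ twinSize tw
    twins-from-pairs = record
      { S = fromList firsts ; T = fromList seconds ; disjoint = disjoint ; φ = shift ; maps-into = maps-into
      ; onto = onto ; monotone = monotone
      ; edges = λ u v u∈ v∈ → mk⇔
          (λ eq → trans (edgeOf-shift u) (trans (cong (mate ps) eq) (sym (edgeOf-shift v))))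
          (unmate u∈ v∈) } ,
      subst (_≤ ∣ fromList firsts ∣) (length-map proj₁ ps)
        (length≤∣fromList∣ (AllPairs.map⁺ (AllPairs.map (λ ap → ap (inj₁ refl) (inj₁ refl)) apart)))

-- Twins in a clique of edges

module CliqueTwins {ℓ n : ℕ} (M : OrderedMatching (suc (suc ℓ)) n) where

  open Positions M

  open Runs ℓ pos (λ e j<k k≤ → pos-mono e j<k (s≤s k≤)) (λ e≢f j≤ k≤ → pos-disjoint e≢f (s≤s j≤) (s≤s k≤)) public
  open Run

  module _ {xs : List (Fin n)} {L : ℕ} (clique : Clique xs (suc L)) (c : ℕ) (c-large : 1152 ≤ c) where

    open Clique clique

    private
      zs : List (Fin n)
      zs = Chain.elems chain

      q-injective : ∀ {e f} → pos e (suc ℓ) ≡ pos f (suc ℓ) → e ≡ f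
      q-injective {e} {f} eq with e ≟ᶠ f
      ... | yes e≡f = e≡f
      ... | no  e≢f = contradiction eq (pos-disjoint e≢f ≤-refl ≤-refl)

    open Halving (λ e → pos e (start lastRun)) (λ e → pos e (stop lastRun)) (λ e → pos e (suc ℓ))
                 (λ e → pos-mono-≤ e (start≤stop lastRun) (stop≤ lastRun))
                 (λ e → pos-mono e (s≤s (bounded lastRun)) ≤-refl) (λ {e} {f} → q-injective {e} {f}) c c-large

    private
      -- `≺` is the order in the last run, whose sign is `true`; so it has the direction of the
      -- chain and determines the orientation in all runs.
      ≺⇒aligned : ∀ {a a′} → a ∈ zs → a′ ∈ zs → a ≺ a′ → Aligned ((lastRun , true) ∷ signing) a a′
      ≺⇒aligned {a} {a′} a∈ a′∈ a≺a′ with AllPairs-lookup (Chain.ordered chain) a∈ a′∈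
      ... | inj₁ refl       = contradiction a≺a′ (≺-irrefl {a})
      ... | inj₂ (inj₁ al)  = al
      ... | inj₂ (inj₂ al)  = contradiction (<-≤-trans a≺a′ (pos-mono-≤ a′ (start≤stop lastRun) (stop≤ lastRun)))
                                (<⇒≯ (<-≤-trans (All.head al) (pos-mono-≤ a (start≤stop lastRun) (stop≤ lastRun))))

      record Inside (xs : List (Fin n)) (P : Fin n × Fin n) : Set where
        constructor inside
        field
          first∈  : proj₁ P ∈ xs
          second∈ : proj₂ P ∈ xs

      Agree : ℕ → ℕ → Rel (Fin n × Fin n) 0ℓ
      Agree j k (a , b) (a′ , b′) = (pos a j < pos a′ k × pos b j < pos b′ k) ⊎ (pos a′ k < pos a j × pos b′ k < pos b j)

      Contains : ℕ → Run → Set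
      Contains j R = start R ≤ j × j ≤ stop R

      pos≤stop : ∀ {R j} e → Contains j R → pos e j ≤ pos e (stop R)
      pos≤stop {R} e (_ , j≤) = pos-mono-≤ e j≤ (stop≤ R)

      start≤pos : ∀ {R j} e → Contains j R → pos e (start R) ≤ pos e j
      start≤pos {R} e (s≤j , j≤) = pos-mono-≤ e s≤j (≤-trans j≤ (stop≤ R))

      left-of : ∀ {S R j k e f} → LeftOf zs S R → e ∈ zs → f ∈ zs → Contains j S → Contains k R → pos e j < pos f k
      left-of {S} {R} {e = e} {f} sep e∈ f∈ j∈S k∈R =
        ≤-<-trans (pos≤stop {S} e j∈S) (<-≤-trans (sep e∈ f∈) (start≤pos {R} f k∈R))

      sign-of : ∀ {R} → R ∈ lastRun ∷ runs → ∃ λ s → (R , s) ∈ (lastRun , true) ∷ signing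
      sign-of (here refl) = true , here refl
      sign-of (there R∈)  = Product.map₂ there (signing-of signing∈ R∈)

      same-run : ∀ {R j k a b a′ b′} → R ∈ lastRun ∷ runs → Contains j R → Contains k R →
                 Aligned ((lastRun , true) ∷ signing) a a′ → Aligned ((lastRun , true) ∷ signing) b b′ →
                 Agree j k (a , b) (a′ , b′)
      same-run {R} {j} {k} R∈ j∈R k∈R al bl with sign-of R∈
      ... | true , ρ∈ = inj₁ (before (All.lookup al ρ∈) , before (All.lookup bl ρ∈))
        where
        before : ∀ {e f} → Before (R , true) e f → pos e j < pos f k
        before {e} {f} lt = ≤-<-trans (pos≤stop {R} e j∈R) (<-≤-trans lt (start≤pos {R} f k∈R))
      ... | false , ρ∈ = inj₂ (before (All.lookup al ρ∈) , before (All.lookup bl ρ∈))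
        where
        before : ∀ {e f} → Before (R , false) e f → pos f k < pos e j
        before {e} {f} lt = ≤-<-trans (pos≤stop {R} f k∈R) (<-≤-trans lt (start≤pos {R} e j∈R))

      Agree-sym : ∀ {j k P P′} → Agree k j P′ P → Agree j k P P′
      Agree-sym (inj₁ lt) = inj₂ lt
      Agree-sym (inj₂ gt) = inj₁ gt

      -- Vertices in different runs are compared by `separated`, those in the same run by its sign.
      runs-agree : ∀ {j k P P′} → Inside zs P → Inside zs P′ → Parallel P P′ → j ≤ ℓ → k ≤ ℓ → Agree j k P P′
      runs-agree {j} {k} {P@(a , b)} {P′@(a′ , b′)} (inside a∈ b∈) (inside a′∈ b′∈) par j≤ k≤
        with find (covers j≤) | find (covers k≤)
      ... | R , R∈ , j∈R | S , S∈ , k∈S with AllPairs-lookup separated R∈ S∈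
      ...   | inj₂ (inj₁ S<R) = inj₂ (left-of {S} {R} S<R a′∈ a∈ k∈S j∈R , left-of {S} {R} S<R b′∈ b∈ k∈S j∈R)
      ...   | inj₂ (inj₂ R<S) = inj₁ (left-of {R} {S} R<S a∈ a′∈ j∈R k∈S , left-of {R} {S} R<S b∈ b′∈ j∈R k∈S)
      ...   | inj₁ refl with par
      ...     | inj₁ (a≺ , b≺) = same-run R∈ j∈R k∈S (≺⇒aligned a∈ a′∈ a≺) (≺⇒aligned b∈ b′∈ b≺)
      ...     | inj₂ (≺a , ≺b) = Agree-sym {P = P} {P′} (same-run R∈ k∈S j∈R (≺⇒aligned a′∈ a∈ ≺a) (≺⇒aligned b′∈ b∈ ≺b))

      -- The other runs lie to the left of the last run, hence of the last vertex, of every edge in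
      -- the chain; only the last run calls for `Clear`.
      q-agree : ∀ {j P P′} → Inside zs P → Inside zs P′ → Clear P P′ → j ≤ ℓ → Agree j (suc ℓ) P P′
      q-agree {j} {P@(a , b)} {P′@(a′ , b′)} (inside a∈ b∈) (inside a′∈ b′∈) clear j≤ = go (covers j≤) clear
        where
        before : ∀ {R e f} → All (λ S → LeftOf zs S lastRun) runs → R ∈ runs → Contains j R → e ∈ zs → f ∈ zs →
                 pos e j < pos f (suc ℓ)
        before {R} {e} {f} left R∈ j∈R e∈ f∈ =
          ≤-<-trans (pos≤stop {R} e j∈R) (<-≤-trans (All.lookup left R∈ e∈ f∈) (pos-mono-≤ f (start≤ lastRun) ≤-refl))
        go : Any (Contains j) (lastRun ∷ runs) → Clear P P′ → Agree j (suc ℓ) P P′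
        go (here j∈R) (inj₁ lt) =
          inj₁ (≤-<-trans (pos≤stop {lastRun} a j∈R) (lt (inj₁ refl) (inj₁ refl)) ,
                ≤-<-trans (pos≤stop {lastRun} b j∈R) (lt (inj₂ refl) (inj₂ refl)))
        go (here j∈R) (inj₂ gt) =
          inj₂ (<-≤-trans (gt (inj₁ refl) (inj₁ refl)) (start≤pos {lastRun} a j∈R) ,
                <-≤-trans (gt (inj₂ refl) (inj₂ refl)) (start≤pos {lastRun} b j∈R))
        go (there any) _ with find any
        ... | R , R∈ , j∈R = inj₁ (before {R} left R∈ j∈R a∈ a′∈ , before {R} left R∈ j∈R b∈ b′∈)
          where left = AllPairs.head separated

      agree : ∀ {P P′} → Inside zs P → Inside zs P′ → Congruent P P′ → ∀ {j k} → j ≤ suc ℓ → k ≤ suc ℓ → Agree j k P P′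
      agree {P} {P′} d d′ (par , apart , clear , clear′) {j} {k} j≤ k≤ with m≤n⇒m<n∨m≡n j≤ | m≤n⇒m<n∨m≡n k≤
      ... | inj₁ (s≤s j≤ℓ) | inj₁ (s≤s k≤ℓ) = runs-agree {P = P} {P′} d d′ par j≤ℓ k≤ℓ
      ... | inj₁ (s≤s j≤ℓ) | inj₂ refl      = q-agree {P = P} {P′} d d′ clear j≤ℓ
      ... | inj₂ refl      | inj₁ (s≤s k≤ℓ) = Agree-sym {P = P} {P′} (q-agree {P = P′} {P} d′ d clear′ k≤ℓ)
      ... | inj₂ refl      | inj₂ refl with apart
      ...   | inj₁ lt = inj₁ (lt (inj₁ refl) (inj₁ refl) , lt (inj₂ refl) (inj₂ refl))
      ...   | inj₂ gt = inj₂ (gt (inj₁ refl) (inj₁ refl) , gt (inj₂ refl) (inj₂ refl))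

      apart⇒≢ : ∀ {P P′} → Congruent P P′ → ∈ₚ-≢ P P′
      apart⇒≢ (_ , inj₁ lt , _) x∈ y∈ refl = <-irrefl refl (lt x∈ y∈)
      apart⇒≢ (_ , inj₂ gt , _) x∈ y∈ refl = <-irrefl refl (gt x∈ y∈)

    clique-twins : ∀ C → (8 * c) ^ 3 ≤ C → 1 ≤ L → Σ (Twins M) λ tw → suc L ^ 3 ≤ C * twinSize tw ^ 5
    clique-twins C C-large 1≤L
      with run-twins C C-large zs (subst (2 ≤_) (sym (Chain.size chain)) (s≤s 1≤L))
             (AllPairs.map All.head (Chain.ordered chain))
    ... | ps , L³≤ , distinct , congruent
      with twins-from-pairs ps (All.map (λ (_ , _ , a≢b) → a≢b) distinct)
             (AllPairs.map (λ {P} {P′} → apart⇒≢ {P} {P′}) congruent) sync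
      where
      in-zs : ∀ {P} → P ∈ ps → Inside zs P
      in-zs P∈ with All.lookup distinct P∈
      ... | a∈ , b∈ , _ = inside a∈ b∈
      resolve : ∀ {j k a b a′ b′} → Agree j k (a , b) (a′ , b′) → pos a j < pos a′ k → pos b j < pos b′ k
      resolve (inj₁ (_ , lt)) _  = lt
      resolve (inj₂ (gt , _)) lt = contradiction lt (<⇒≯ gt)
      sync : ∀ {a b a′ b′} → (a , b) ∈ ps → (a′ , b′) ∈ ps → ∀ {j k} → j < suc (suc ℓ) → k < suc (suc ℓ) →
             pos a j < pos a′ k → pos b j < pos b′ k
      sync {a} {b} {a′} {b′} P∈ P′∈ {j} {k} (s≤s j≤) (s≤s k≤) with AllPairs-lookup congruent P∈ P′∈
      -- Within one pair, the order of two vertices of `a` is that of their indices, which `b`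
      -- shares.
      ... | inj₁ refl = λ lt → pos-mono b (≰⇒> λ k≤j → <⇒≱ lt (pos-mono-≤ a k≤j j≤)) (s≤s k≤)
      ... | inj₂ (inj₁ congr) = resolve {j} {k} {a} {b} {a′} {b′} (agree (in-zs P∈) (in-zs P′∈) congr j≤ k≤)
      ... | inj₂ (inj₂ congr) = resolve {j} {k} {a} {b} {a′} {b′}
              (Agree-sym {j} {k} {a , b} {a′ , b′} (agree (in-zs P′∈) (in-zs P∈) congr k≤ j≤))
    ...   | tw , len≤ = tw , ≤-trans (subst (λ m → m ^ 3 ≤ C * length ps ^ 5) (Chain.size chain) L³≤)
                                     (*-monoʳ-≤ C (^-monoˡ-≤ 5 len≤))

  wholeRun : Run
  wholeRun = record { start = 0 ; gaps = ℓ ; bounded = ≤-refl }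

  -- The iteration starts from a single run with `ℓ` gaps, whence the exponent 1 = 2^0.
  edge-clique : ∀ L → cliqueBound ℓ (L ^ 1) < n → Clique (allFin n) (suc L)
  edge-clique L lt = erdős–szekeres L ℓ 0 (wholeRun ∷ []) (allFin n) (+-identityʳ ℓ) refl (allFin⁺ n)
    (λ j≤ℓ → here (z≤n , j≤ℓ)) ([] ∷ []) (subst (cliqueBound ℓ (L ^ 1) <_) (sym (length-tabulate {n = n} id)) lt)

-- The final exponent and constants

-- Each step of `cliqueBound` squares `X` and multiplies by `X`, so the exponent passes from e to 2e
-- + 1; it is 1 + 2 + ... + 2^t.
cliqueExponent cliqueConstant : ℕ → ℕ
cliqueExponent zero    = 1
cliqueExponent (suc t) = suc (2 * cliqueExponent t)
cliqueConstant zero    = 1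
cliqueConstant (suc t) = suc (2 * (suc t * cliqueConstant t))

cliqueExponent≡ : ∀ t → cliqueExponent t ≡ 2 ^ suc t ∸ 1
cliqueExponent≡ t = cong (_∸ 1) (lemma t)
  where
  lemma : ∀ t → suc (cliqueExponent t) ≡ 2 ^ suc t
  lemma zero    = refl
  lemma (suc t) = trans (double (cliqueExponent t)) (cong (2 *_) (lemma t))
    where
    double : ∀ e → suc (suc (2 * e)) ≡ 2 * suc e
    double = solve-∀

cliqueBound≤ : ∀ t X → 1 ≤ X → cliqueBound t X ≤ cliqueConstant t * X ^ cliqueExponent t
cliqueBound≤ zero    X 1≤X = ≤-reflexive (trans (*-identityʳ X) (sym (trans (*-identityˡ (X * 1)) (*-identityʳ X))))
cliqueBound≤ (suc t) X 1≤X = begin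
  X * suc (2 * (suc t * cliqueBound t (X * X)))
    ≤⟨ *-monoʳ-≤ X (s≤s (*-monoʳ-≤ 2 (*-monoʳ-≤ (suc t) (cliqueBound≤ t (X * X) (*-mono-≤ 1≤X 1≤X))))) ⟩
  X * suc (2 * (suc t * (K * (X * X) ^ e)))
    -- The 1 in `suc` is absorbed by the power of `X * X`, which is at least 1.
    ≤⟨ *-monoʳ-≤ X (+-monoˡ-≤ _ (m^n>0 (X * X) {{>-nonZero (*-mono-≤ 1≤X 1≤X)}} e)) ⟩
  X * ((X * X) ^ e + 2 * (suc t * (K * (X * X) ^ e)))
    ≡⟨ factor X ((X * X) ^ e) (suc t) K ⟩
  suc (2 * (suc t * K)) * (X * (X * X) ^ e)
    ≡⟨ cong (λ Y → suc (2 * (suc t * K)) * (X * Y)) (trans (cong (λ Y → (X * Y) ^ e) (sym (*-identityʳ X))) (^-*-assoc X 2 e)) ⟩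
  suc (2 * (suc t * K)) * (X * X ^ (2 * e))
    ∎
  where
  open ≤-Reasoning
  K = cliqueConstant t
  e = cliqueExponent t
  factor : ∀ X Y u K → X * (Y + 2 * (u * (K * Y))) ≡ suc (2 * (u * K)) * (X * Y)
  factor = solve-∀

-- Up to constants n³ is at most (m³)^D, and m³ at most s⁵. The constants move inside the power,
-- since K³ ≤ K⁵ and 8C ≤ (8C)⁵.
combine-bounds : ∀ K C D n m s .{{_ : NonZero K}} .{{_ : NonZero C}} .{{_ : NonZero D}} →
                 n ≤ K * (2 * m) ^ D → m ^ 3 ≤ C * s ^ 5 → n ^ 3 ≤ (K * (8 * C) * s) ^ (5 * D)
combine-bounds K C D n m s n≤ m³≤ = begin
  n ^ 3                                  ≤⟨ ^-monoˡ-≤ 3 n≤ ⟩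
  (K * (2 * m) ^ D) ^ 3                  ≡⟨ ^-distribʳ-* K ((2 * m) ^ D) 3 ⟩
  K ^ 3 * ((2 * m) ^ D) ^ 3              ≡⟨ cong (K ^ 3 *_) (^-swap (2 * m) D 3) ⟩
  K ^ 3 * ((2 * m) ^ 3) ^ D              ≤⟨ *-mono-≤ (≤-trans (^-monoʳ-≤ K (m≤m+n 3 2)) (m≤m^n (K ^ 5) D)) (^-monoˡ-≤ D 8m³≤) ⟩
  (K ^ 5) ^ D * ((8 * C * s) ^ 5) ^ D    ≡⟨ ^-distribʳ-* (K ^ 5) ((8 * C * s) ^ 5) D ⟨
  (K ^ 5 * (8 * C * s) ^ 5) ^ D          ≡⟨ cong (_^ D) (^-distribʳ-* K (8 * C * s) 5) ⟨
  ((K * (8 * C * s)) ^ 5) ^ D            ≡⟨ ^-*-assoc (K * (8 * C * s)) 5 D ⟩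
  (K * (8 * C * s)) ^ (5 * D)            ≡⟨ cong (_^ (5 * D)) (*-assoc K (8 * C) s) ⟨
  (K * (8 * C) * s) ^ (5 * D)            ∎
  where
  open ≤-Reasoning
  ^-swap : ∀ a i j → (a ^ i) ^ j ≡ (a ^ j) ^ i
  ^-swap a i j = trans (^-*-assoc a i j) (trans (cong (a ^_) (*-comm i j)) (sym (^-*-assoc a j i)))
  8m³≤ : (2 * m) ^ 3 ≤ (8 * C * s) ^ 5
  8m³≤ = begin
    (2 * m) ^ 3          ≡⟨ ^-distribʳ-* 2 m 3 ⟩
    2 ^ 3 * m ^ 3        ≤⟨ *-monoʳ-≤ (2 ^ 3) m³≤ ⟩
    2 ^ 3 * (C * s ^ 5)  ≡⟨ *-assoc (2 ^ 3) C (s ^ 5) ⟨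
    8 * C * s ^ 5        ≤⟨ *-monoˡ-≤ (s ^ 5) (m≤m^n (8 * C) 5) ⟩
    (8 * C) ^ 5 * s ^ 5  ≡⟨ ^-distribʳ-* (8 * C) s 5 ⟨
    (8 * C * s) ^ 5      ∎

module _ (c : ℕ) (c-large : 1152 ≤ c) where

  private
    C : ℕ
    C = (8 * c) ^ 3

    instance
      c-nonZero : NonZero c
      c-nonZero = >-nonZero (≤-trans (s≤s z≤n) c-large)

      8c-nonZero : NonZero (8 * c)
      8c-nonZero = m*n≢0 8 c

      C-nonZero : NonZero C
      C-nonZero = m^n≢0 (8 * c) 3

      cliqueConstant-nonZero : ∀ {t} → NonZero (cliqueConstant t)
      cliqueConstant-nonZero {zero}  = _
      cliqueConstant-nonZero {suc t} = _

      cliqueExponent-nonZero : ∀ {t} → NonZero (cliqueExponent t)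
      cliqueExponent-nonZero {zero}  = _
      cliqueExponent-nonZero {suc t} = _

  -- Let f u ≤ n ≤ f (2u). The left inequality yields a clique of u + 1 edges, the right one bounds
  -- n by a multiple of (2(u + 1))^D. The conclusion says that `twinSize` is at least n^(3/expDen
  -- r)/q, so c_r is 1/q.
  twins-bound : ∀ (r : ℕ) → 2 ≤ r →
    Σ ℕ (λ q → 1 ≤ q × Σ ℕ (λ n₀ → ∀ (n : ℕ) → n₀ ≤ n →
      ∀ (M : OrderedMatching r n) → Σ (Twins M) (λ tw →
        n ^ 3 ≤ (q * twinSize tw) ^ expDen r)))
  twins-bound (suc zero)    (s≤s ())
  -- The factor 2 before `K` absorbs the `suc` in `f`, and the choice of `f 1` for n₀ ensures that a
  -- suitable u ≥ 1 exists.
  twins-bound (suc (suc ℓ)) _ = 2 * K * (8 * C) , >-nonZero⁻¹ (2 * K * (8 * C)) , f 1 , large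
    where
    K D : ℕ
    K = cliqueConstant ℓ
    D = cliqueExponent ℓ
    f : ℕ → ℕ
    f u = suc (K * u ^ D)
    instance
      2K-nonZero : NonZero (2 * K)
      2K-nonZero = m*n≢0 2 K {{_}} {{cliqueConstant-nonZero {ℓ}}}
      8C-nonZero : NonZero (8 * C)
      8C-nonZero = m*n≢0 8 C
      q-nonZero : NonZero (2 * K * (8 * C))
      q-nonZero = m*n≢0 (2 * K) (8 * C)
    f-mono : ∀ {a b} → a ≤ b → f a ≤ f b
    f-mono a≤b = s≤s (*-monoʳ-≤ K (^-monoˡ-≤ D a≤b))
    f≤ : ∀ u → 1 ≤ u → f (u + u) ≤ 2 * K * (2 * suc u) ^ D
    f≤ u 1≤u = begin
      suc (K * (u + u) ^ D)                        ≤⟨ +-mono-≤ (*-mono-≤ (>-nonZero⁻¹ K {{cliqueConstant-nonZero {ℓ}}})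
                                                        (m^n>0 (2 * suc u) D)) (*-monoʳ-≤ K (^-monoˡ-≤ D 2u≤)) ⟩
      K * (2 * suc u) ^ D + K * (2 * suc u) ^ D    ≡⟨ double K ((2 * suc u) ^ D) ⟩
      2 * K * (2 * suc u) ^ D                      ∎
      where
      open ≤-Reasoning
      2u≤ : u + u ≤ 2 * suc u
      2u≤ = +-mono-≤ (n≤1+n u) (≤-trans (n≤1+n u) (m≤m+n (suc u) 0))
      double : ∀ a b → a * b + a * b ≡ 2 * a * b
      double = solve-∀
    n<f : ∀ n → n < f (suc n)
    n<f n = s≤s (≤-trans (n≤1+n n) (≤-trans (m≤m^n (suc n) D {{cliqueExponent-nonZero {ℓ}}})
              (m≤n*m (suc n ^ D) K {{cliqueConstant-nonZero {ℓ}}})))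
    exponent : 5 * D ≡ expDen (suc (suc ℓ))
    exponent = cong (5 *_) (cliqueExponent≡ ℓ)
    large : ∀ n → f 1 ≤ n → ∀ (M : OrderedMatching (suc (suc ℓ)) n) → Σ (Twins M) λ tw →
            n ^ 3 ≤ (2 * K * (8 * C) * twinSize tw) ^ expDen (suc (suc ℓ))
    large n f1≤n M = go (dyadic-inverse f f-mono n f1≤n (n<f n))
      where
      open CliqueTwins M
      go : (∃ λ u → 1 ≤ u × f u ≤ n × n ≤ f (u + u)) → Σ (Twins M) λ tw →
           n ^ 3 ≤ (2 * K * (8 * C) * twinSize tw) ^ expDen (suc (suc ℓ))
      go (u , 1≤u , fu≤n , n≤f) = Product.map₂ (λ {tw} → bound (twinSize tw))
          (clique-twins (edge-clique u bound<n) c c-large C ≤-refl 1≤u)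
        where
        bound<n : cliqueBound ℓ (u ^ 1) < n
        bound<n = ≤-trans (s≤s (subst (λ X → cliqueBound ℓ X ≤ K * u ^ D) (sym (*-identityʳ u)) (cliqueBound≤ ℓ u 1≤u))) fu≤n
        bound : ∀ s → suc u ^ 3 ≤ C * s ^ 5 → n ^ 3 ≤ (2 * K * (8 * C) * s) ^ expDen (suc (suc ℓ))
        bound s m³≤ = subst (λ d → n ^ 3 ≤ (2 * K * (8 * C) * s) ^ d) exponent
          (combine-bounds (2 * K) C D n (suc u) s {{2K-nonZero}} {{C-nonZero}} {{cliqueExponent-nonZero {ℓ}}}
            (≤-trans n≤f (f≤ u 1≤u)) m³≤)

theorem1p2 : ∀ (r : ℕ) → 2 ≤ r →
    Σ ℕ (λ q → 1 ≤ q × Σ ℕ (λ n₀ → ∀ (n : ℕ) → n₀ ≤ n →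
    ∀ (M : OrderedMatching r n) → Σ (Twins M) (λ tw →
    n ^ 3 ≤ (q * twinSize tw) ^ expDen r)))
theorem1p2 = twins-bound 1152 ≤-refl
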